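{- There is an absolute constant $c>0$ such that the following holds. Let $n\ge1$, let $0\le\alpha\le1$, and let $S\subseteq\mathbb{F}_2^n$ satisfy $|S|\ge\alpha 2^n$. Then $\rho(S)\ge c\,\alpha^{1/2}n^{1/2}$.
   Context: For $x,y\in\mathbb{F}_2^n$, $d_H(x,y)=\#\{i:x_i\neq y_i\}$ is the Hamming distance. A set $R\subseteq\mathbb{F}_2^n$ is called rainbow if all $\binom{|R|}{2}$ Hamming distances over unordered pairs of distinct points of $R$ are pairwise distinct. $\rho(S)$ is the maximum size of a rainbow subset of $S$. The paper states the conclusion as $\rho(S)=\Omega(\alpha^{1/2}n^{1/2})$. -}

module Defs where

open import Data.Bool using (Bool; true; false; _xor_)
open import Data.Nat using (ℕ; zero; suc)
open import Data.Integer using (+_)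
open import Data.Rational using (ℚ; _/_)
open import Data.Vec using (Vec; []; _∷_)
open import Data.List using (List; []; _∷_; map; _++_)
open import Data.List.Relation.Unary.Unique.Propositional using (Unique)
open import Data.List.Relation.Unary.All using (All)
open import Data.List.Membership.Propositional using (_∈_)
open import Data.Product using (_×_)

F₂^ : ℕ → Set
F₂^ n = Vec Bool n

dH : ∀ {n} → F₂^ n → F₂^ n → ℕ
dH []       []       = zero
dH (a ∷ x) (b ∷ y) with a xor b
... | true  = suc (dH x y)
... | false = dH x y

pairDists : ∀ {n} → List (F₂^ n) → List ℕ
pairDists []       = []
pairDists (x ∷ xs) = map (dH x) xs ++ pairDists xs

Rainbow : ∀ {n} → List (F₂^ n) → Set
Rainbow R = Unique R × Unique (pairDists R)

RainbowSubset : ∀ {n} → List (F₂^ n) → List (F₂^ n) → Set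
RainbowSubset S R = Rainbow R × All (_∈ S) R

toℚ : ℕ → ℚ
toℚ n = + n / 1

{-# OPTIONS --safe #-}
module Submission where

-- Averaging over x, some path x, x + e₁, x + e₁ + e₂, … has at least α n of its first n points in S, and distances
-- along the path are differences of positions. So it suffices that every set of m integers contains a Sidon set of
-- size ≫ √m (Komlós, Sulyok, Szemerédi). For this, let p ≍ √m be prime and scale the Erdős–Turán Sidon set
-- {2 p i + (i² mod p) : i < p} to p short intervals ("cells") of length w inside Z/q, with q a large prime and
-- w ≈ q/(8p²). A random affine map of Z/q puts ≫ √m elements of the set into cells, with few coincidences in the
-- same cell; choosing one element from each cell that is hit gives a Sidon set.
-- A prime p of the right size exists because the least common multiple of 1, …, N is at least 2^(N − 1), whereas it
-- would be smaller if there were no primes in (N/16, N].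

open import Defs
open import Data.Nat using (ℕ; _≤_; _^_; _*_)
open import Data.Rational using (ℚ; 0ℚ; 1ℚ) renaming (_≤_ to _≤ℚ_; _<_ to _<ℚ_; _*_ to _*ℚ_)
open import Data.List using (List; length)
open import Data.List.Relation.Unary.Unique.Propositional using (Unique)
open import Data.Product using (_×_; ∃-syntax)
open import Data.Bool using (true; false; if_then_else_; not)
import Data.Bool.Properties as Bool
open import Data.Empty using (⊥)
import Data.Integer as ℤ
import Data.Integer.Properties as ℤ
import Data.Integer.Tactic.RingSolver as ℤ-Solver
open import Data.List using ([]; _∷_; map; filter; downFrom)
open import Data.List.Properties using (length-map; map-∘)
import Data.List.Membership.DecPropositional as DecMembership
open import Data.List.Membership.Propositional using (_∈_)
open import Data.List.Membership.Propositional.Properties using (∈-map⁻; ∈-++⁻; ∈-filter⁻; ∈-downFrom⁻)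
open import Data.List.Relation.Unary.All as All using ([]; _∷_)
import Data.List.Relation.Unary.All.Properties as All
open import Data.List.Relation.Unary.AllPairs using ([]; _∷_)
open import Data.List.Relation.Unary.Any using (here; there)
import Data.List.Relation.Unary.Unique.Propositional.Properties as Unique
open import Data.Nat
open import Data.Nat.Combinatorics using (_C_; nCk+nC[k+1]≡[n+1]C[k+1]; k![n∸k]!∣n!)
open import Data.Nat.Combinatorics.Specification using (nCk≡n!/k![n-k]!; k>n⇒nCk≡0)
open import Data.Nat.Divisibility
open import Data.Nat.DivMod
open import Data.Nat.Primality
open import Data.Nat.Properties
open import Data.Nat.Tactic.RingSolver using (solve-∀)
open import Data.Product using (_,_; proj₁; proj₂)
open import Data.Rational using (1/_; Positive; NonNegative; toℚᵘ) renaming (NonZero to NonZeroℚ)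
import Data.Rational.Properties as ℚ
open import Data.Rational.Unnormalised as ℚᵘ using (mkℚᵘ; *≤*)
import Data.Rational.Unnormalised.Properties as ℚᵘ
open import Data.Sum using (_⊎_; inj₁; inj₂; [_,_]′)
open import Data.Vec using ([]; _∷_)
open import Data.Vec.Properties using (≡-dec)
open import Level using (Level)
open import Relation.Binary using (DecidableEquality)
open import Relation.Binary.PropositionalEquality hiding (J)
open import Relation.Nullary using (Dec; yes; no; does; ¬_; contradiction; _×-dec_)
open import Relation.Nullary.Decidable using (from-yes)
open import Relation.Unary using (Pred; Decidable)

-- Finite sums

-- A greedy choice among m integers only yields a Sidon set of order m^(1/3). To reach √m, the set
-- borrows the additive independence of a fixed dense Sidon set, one element per cell. For a random
-- map the expected number of elements in cells is p m w / q, about m/(8p), which has order √m when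
-- p has. The expected number of pairs sharing a cell is at most p (m w / q)², and m ≤ p² makes this
-- at most an eighth of the former. Only the joint distribution of two images enters, which affine
-- maps modulo a prime make uniform. The 8 in w ≈ q/(8p²) is 2·2·2: the ruler has base 2p rather
-- than p, so that residues add without carry; cells are spaced by 2w, so that offsets add without
-- carry; only half of Z/q is used, so that sums do not wrap around. On the prime side, the upper
-- bound 2^(4N) for a common multiple of 1, ..., N does not contradict the lower bound 2^(4N - 1)
-- that holds up to 4N. Hence the range of ratio 16.

private variable
  ℓ : Level

∑ : ℕ → (ℕ → ℕ) → ℕ
∑ zero    f = 0
∑ (suc n) f = ∑ n f + f n

∑-mono : ∀ n {f g : ℕ → ℕ} → (∀ i → i < n → f i ≤ g i) → ∑ n f ≤ ∑ n g
∑-mono zero    h = z≤n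
∑-mono (suc n) h = +-mono-≤ (∑-mono n (λ i i<n → h i (m<n⇒m<1+n i<n))) (h n ≤-refl)

∑-cong : ∀ n {f g : ℕ → ℕ} → (∀ i → i < n → f i ≡ g i) → ∑ n f ≡ ∑ n g
∑-cong n h = ≤-antisym (∑-mono n (λ i i<n → ≤-reflexive (h i i<n)))
                       (∑-mono n (λ i i<n → ≤-reflexive (sym (h i i<n))))

∑-const : ∀ n k → ∑ n (λ _ → k) ≡ n * k
∑-const zero    k = refl
∑-const (suc n) k = trans (cong (_+ k) (∑-const n k)) (+-comm (n * k) k)

+-interchange : ∀ a b c d → (a + b) + (c + d) ≡ (a + c) + (b + d)
+-interchange = solve-∀

∑-+ : ∀ n f g → ∑ n (λ i → f i + g i) ≡ ∑ n f + ∑ n g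
∑-+ zero    f g = refl
∑-+ (suc n) f g = trans (cong (_+ (f n + g n)) (∑-+ n f g)) (+-interchange (∑ n f) (∑ n g) (f n) (g n))

∑-*ˡ : ∀ n k f → ∑ n (λ i → k * f i) ≡ k * ∑ n f
∑-*ˡ zero    k f = sym (*-zeroʳ k)
∑-*ˡ (suc n) k f = trans (cong (_+ k * f n) (∑-*ˡ n k f)) (sym (*-distribˡ-+ k (∑ n f) (f n)))

∑-*ʳ : ∀ n k f → ∑ n (λ i → f i * k) ≡ ∑ n f * k
∑-*ʳ n k f = trans (∑-cong n (λ i _ → *-comm (f i) k)) (trans (∑-*ˡ n k f) (*-comm k (∑ n f)))

∑-zero : ∀ n {f} → (∀ i → i < n → f i ≡ 0) → ∑ n f ≡ 0
∑-zero n h = trans (∑-cong n h) (trans (∑-const n 0) (*-zeroʳ n))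

∑-swap : ∀ n m (f : ℕ → ℕ → ℕ) → ∑ n (λ i → ∑ m (λ j → f i j)) ≡ ∑ m (λ j → ∑ n (λ i → f i j))
∑-swap zero    m f = sym (∑-zero m (λ _ _ → refl))
∑-swap (suc n) m f = trans (cong (_+ ∑ m (f n)) (∑-swap n m f))
                           (sym (∑-+ m (λ j → ∑ n (λ i → f i j)) (f n)))

∑-split : ∀ m n f → ∑ (m + n) f ≡ ∑ m f + ∑ n (λ i → f (m + i))
∑-split m zero    f = trans (cong (λ k → ∑ k f) (+-identityʳ m)) (sym (+-identityʳ _))
∑-split m (suc n) f rewrite +-suc m n =
  trans (cong (_+ f (m + n)) (∑-split m n f)) (+-assoc (∑ m f) _ _)

∑-max : ∀ n → 1 ≤ n → ∀ f → ∃[ i ] (i < n × ∑ n f ≤ n * f i)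
∑-max (suc zero)    _ f = 0 , s≤s z≤n , ≤-reflexive (+-comm 0 (f 0))
∑-max (suc (suc n)) _ f with ∑-max (suc n) (s≤s z≤n) f
... | i , i<n , h with ≤-total (f i) (f (suc n))
... | inj₁ le = suc n , ≤-refl , ≤-trans (+-mono-≤ (≤-trans h (*-monoʳ-≤ (suc n) le)) ≤-refl)
                                         (≤-reflexive (+-comm (suc n * f (suc n)) _))
... | inj₂ ge = i , m<n⇒m<1+n i<n , ≤-trans (+-mono-≤ h ge) (≤-reflexive (+-comm (suc n * f i) _))

-- The default 0 of a failed search is harmless: `find-correct` speaks only of positive sums.
find : ℕ → (ℕ → ℕ) → ℕ
find zero    f = 0
find (suc n) f with 1 ≤? f n
... | yes _ = n
... | no  _ = find n f

find-correct : ∀ n f → 1 ≤ ∑ n f → find n f < n × 1 ≤ f (find n f)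
find-correct zero    f ()
find-correct (suc n) f h with 1 ≤? f n
... | yes p = ≤-refl , p
... | no ¬p with find-correct n f (subst (1 ≤_) (trans (cong (∑ n f +_) (n<1⇒n≡0 (≰⇒> ¬p))) (+-identityʳ _)) h)
... | i<n , q = m<n⇒m<1+n i<n , q

𝟙 : ∀ {P : Set ℓ} → Dec P → ℕ
𝟙 d = if does d then 1 else 0

𝟙≤1 : ∀ {P : Set ℓ} (d : Dec P) → 𝟙 d ≤ 1
𝟙≤1 (yes _) = ≤-refl
𝟙≤1 (no _)  = z≤n

𝟙-yes : ∀ {P : Set ℓ} (d : Dec P) → P → 𝟙 d ≡ 1
𝟙-yes (yes _) p = refl
𝟙-yes (no ¬p) p = contradiction p ¬p

𝟙-no : ∀ {P : Set ℓ} (d : Dec P) → ¬ P → 𝟙 d ≡ 0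
𝟙-no (yes p) ¬p = contradiction p ¬p
𝟙-no (no _)  ¬p = refl

𝟙⁻¹ : ∀ {P : Set ℓ} (d : Dec P) → 1 ≤ 𝟙 d → P
𝟙⁻¹ (yes p) _ = p

length-filter-downFrom : ∀ {P : Pred ℕ ℓ} (P? : Decidable P) n → length (filter P? (downFrom n)) ≡ ∑ n (λ i → 𝟙 (P? i))
length-filter-downFrom P? zero = refl
length-filter-downFrom P? (suc n) with P? n
... | yes _ = trans (cong suc (length-filter-downFrom P? n)) (+-comm 1 _)
... | no _  = trans (length-filter-downFrom P? n) (sym (+-identityʳ _))

∑-δ : ∀ n k → k < n → ∑ n (λ i → 𝟙 (i ≟ k)) ≡ 1
∑-δ (suc n) k k<1+n with n ≟ k
... | yes refl = cong₂ _+_ (∑-zero n (λ i i<n → 𝟙-no (i ≟ n) (<⇒≢ i<n))) (𝟙-yes (n ≟ n) refl)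
... | no n≢k   = cong₂ _+_ (∑-δ n k (≤∧≢⇒< (s≤s⁻¹ k<1+n) (λ e → n≢k (sym e)))) (𝟙-no (n ≟ k) n≢k)

∑-δ-inj : ∀ n (f : ℕ → ℕ) v → (∀ i j → i < n → j < n → f i ≡ f j → i ≡ j) → ∑ n (λ i → 𝟙 (v ≟ f i)) ≤ 1
∑-δ-inj zero    f v inj = z≤n
∑-δ-inj (suc n) f v inj with v ≟ f n
... | no v≢    = ≤-trans (≤-reflexive (trans (cong (∑ n (λ i → 𝟙 (v ≟ f i)) +_) (𝟙-no (v ≟ f n) v≢)) (+-identityʳ _)))
                         (∑-δ-inj n f v (λ i j i<n j<n → inj i j (m<n⇒m<1+n i<n) (m<n⇒m<1+n j<n)))
... | yes refl = +-mono-≤ (≤-reflexive (∑-zero n (λ i i<n → 𝟙-no (f n ≟ f i)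
                   (λ e → <⇒≢ i<n (sym (inj n i ≤-refl (m<n⇒m<1+n i<n) e))))))
                   (𝟙≤1 (f n ≟ f n))

∑-δ-* : ∀ n k (F : ℕ → ℕ) → k < n → ∑ n (λ v → 𝟙 (v ≟ k) * F v) ≡ F k
∑-δ-* n k F k<n = trans (∑-cong n (λ v _ → aux v)) (trans (∑-*ʳ n (F k) (λ v → 𝟙 (v ≟ k)))
                   (trans (cong (_* F k) (∑-δ n k k<n)) (*-identityˡ _)))
  where
  aux : ∀ v → 𝟙 (v ≟ k) * F v ≡ 𝟙 (v ≟ k) * F k
  aux v with v ≟ k
  ... | yes refl = refl
  ... | no v≢k   = trans (cong (_* F v) (𝟙-no (v ≟ k) v≢k)) (sym (cong (_* F k) (𝟙-no (v ≟ k) v≢k)))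

-- Expanding `F (f i)` over the possible values v and exchanging the sums counts `F v` once for each
-- preimage of v, of which there is at most one.
∑-injection-≤ : ∀ n (f F : ℕ → ℕ) → (∀ i → i < n → f i < n) →
                (∀ i j → i < n → j < n → f i ≡ f j → i ≡ j) → ∑ n (λ i → F (f i)) ≤ ∑ n F
∑-injection-≤ n f F bound inj = begin
  ∑ n (λ i → F (f i))                          ≡⟨ ∑-cong n (λ i i<n → ∑-δ-* n (f i) F (bound i i<n)) ⟨
  ∑ n (λ i → ∑ n (λ v → 𝟙 (v ≟ f i) * F v))    ≡⟨ ∑-swap n n _ ⟩
  ∑ n (λ v → ∑ n (λ i → 𝟙 (v ≟ f i) * F v))    ≡⟨ ∑-cong n (λ v _ → ∑-*ʳ n (F v) _) ⟩
  ∑ n (λ v → ∑ n (λ i → 𝟙 (v ≟ f i)) * F v)    ≤⟨ ∑-mono n (λ v _ → *-monoˡ-≤ (F v) (∑-δ-inj n f v inj)) ⟩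
  ∑ n (λ v → 1 * F v)                          ≡⟨ ∑-cong n (λ v _ → *-identityˡ (F v)) ⟩
  ∑ n F                                        ∎
  where open ≤-Reasoning

-- Primes in short ranges

CommonMultiple : ℕ → ℕ → Set
CommonMultiple n L = ∀ j → 1 ≤ j → j ≤ n → j ∣ L

absorption : ∀ n k → suc k * (suc n C suc k) ≡ suc n * (n C k)
absorption zero    zero    = refl
absorption zero    (suc k) = trans (cong (suc (suc k) *_) (k>n⇒nCk≡0 {1} {suc (suc k)} (s≤s (s≤s z≤n)))) (*-zeroʳ (suc (suc k)))
absorption (suc n) zero    = begin
  1 * (suc (suc n) C 1)            ≡⟨ cong (1 *_) (nCk+nC[k+1]≡[n+1]C[k+1] (suc n) 0) ⟨
  1 * (1 + (suc n C 1))            ≡⟨ cong suc (absorption n 0) ⟩ 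
  suc (suc n * 1)                  ∎
  where open ≡-Reasoning
absorption (suc n) (suc k) = begin
  suc (suc k) * (suc (suc n) C suc (suc k))
    ≡⟨ cong (suc (suc k) *_) (nCk+nC[k+1]≡[n+1]C[k+1] (suc n) (suc k)) ⟨
  suc (suc k) * ((suc n C suc k) + (suc n C suc (suc k)))
    ≡⟨ lem₁ k (suc n C suc k) _ ⟩
  (suc n C suc k) + suc k * (suc n C suc k) + suc (suc k) * (suc n C suc (suc k))
    ≡⟨ cong₂ (λ x y → (suc n C suc k) + x + y) (absorption n k) (absorption n (suc k)) ⟩
  (suc n C suc k) + suc n * (n C k) + suc n * (n C suc k)
    ≡⟨ lem₂ n (suc n C suc k) (n C k) (n C suc k) ⟩
  (suc n C suc k) + suc n * ((n C k) + (n C suc k))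
    ≡⟨ cong (λ x → (suc n C suc k) + suc n * x) (nCk+nC[k+1]≡[n+1]C[k+1] n k) ⟩
  suc (suc n) * (suc n C suc k) ∎
  where
  open ≡-Reasoning
  lem₁ : ∀ k a b → suc (suc k) * (a + b) ≡ a + suc k * a + suc (suc k) * b
  lem₁ = solve-∀
  lem₂ : ∀ n a b c → a + suc n * b + suc n * c ≡ a + suc n * (b + c)
  lem₂ = solve-∀

-- The entries of the Leibniz harmonic triangle satisfy 1/D = 1/B − 1/A, so L/D is an integer once L/A and L/B are.
leibniz : ∀ {L} n k → k ≤ n → CommonMultiple (suc n) L → suc n * (n C k) ∣ L
leibniz {L} n zero _ cm = subst (_∣ L) (sym (*-identityʳ (suc n))) (cm (suc n) (s≤s z≤n) ≤-refl)
leibniz {L} (suc n) (suc k) (s≤s k≤n) cm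
  with leibniz (suc n) k (m≤n⇒m≤1+n k≤n) cm | leibniz n k k≤n (λ j 1≤j j≤n → cm j 1≤j (m≤n⇒m≤1+n j≤n))
... | divides a L≡aA | divides b L≡bB = ∣m+n∣m⇒∣n (divides b sum≡) (divides a refl)
  where
  open ≡-Reasoning
  A = suc (suc n) * (suc n C k)
  B = suc n * (n C k)
  D = suc (suc n) * (suc n C suc k)
  kD≡nB : suc k * D ≡ suc (suc n) * B
  kD≡nB = begin
    suc k * D                                     ≡⟨ swap (suc k) (suc (suc n)) (suc n C suc k) ⟩
    suc (suc n) * (suc k * (suc n C suc k))       ≡⟨ cong (suc (suc n) *_) (absorption n k) ⟩
    suc (suc n) * B                               ∎
    where
    swap : ∀ x y z → x * (y * z) ≡ y * (x * z)
    swap = solve-∀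
  kD+kA≡nA : suc k * D + suc k * A ≡ suc (suc n) * A
  kD+kA≡nA = begin
    suc k * D + suc k * A
      ≡⟨ fact (suc k) (suc (suc n)) (suc n C suc k) (suc n C k) ⟩
    suc (suc n) * (suc k * ((suc n C k) + (suc n C suc k)))
      ≡⟨ cong (λ x → suc (suc n) * (suc k * x)) (nCk+nC[k+1]≡[n+1]C[k+1] (suc n) k) ⟩
    suc (suc n) * (suc k * (suc (suc n) C suc k))
      ≡⟨ cong (suc (suc n) *_) (absorption (suc n) k) ⟩
    suc (suc n) * A ∎
    where
    fact : ∀ x y z w → x * (y * z) + x * (y * w) ≡ y * (x * (w + z))
    fact = solve-∀
  -- This is L = (b - a) D without subtraction; `D` divides both multiples and therefore `L`.
  sum≡ : a * D + L ≡ b * D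
  sum≡ = *-cancelˡ-≡ _ _ (suc k) (begin
    suc k * (a * D + L)               ≡⟨ cong (λ x → suc k * (a * D + x)) L≡aA ⟩
    suc k * (a * D + a * A)           ≡⟨ r₁ (suc k) a D A ⟩
    a * (suc k * D + suc k * A)       ≡⟨ cong (a *_) kD+kA≡nA ⟩
    a * (suc (suc n) * A)             ≡⟨ r₂ a (suc (suc n)) A ⟩
    suc (suc n) * (a * A)             ≡⟨ cong (suc (suc n) *_) (trans (sym L≡aA) L≡bB) ⟩
    suc (suc n) * (b * B)             ≡⟨ r₂ b (suc (suc n)) B ⟨
    b * (suc (suc n) * B)             ≡⟨ cong (b *_) kD≡nB ⟨
    b * (suc k * D)                   ≡⟨ r₂ b (suc k) D ⟩
    suc k * (b * D)                   ∎)
    where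
    r₁ : ∀ k a d e → k * (a * d + a * e) ≡ a * (k * d + k * e)
    r₁ = solve-∀
    r₂ : ∀ a n e → a * (n * e) ≡ n * (a * e)
    r₂ = solve-∀

∑-binomial : ∀ n → ∑ (suc n) (n C_) ≡ 2 ^ n
∑-binomial zero = refl
∑-binomial (suc n) = begin
  ∑ (suc (suc n)) (suc n C_)                                    ≡⟨ ∑-split 1 (suc n) _ ⟩
  1 + ∑ (suc n) (λ k → suc n C suc k)
    ≡⟨ cong (1 +_) (∑-cong (suc n) (λ k _ → sym (nCk+nC[k+1]≡[n+1]C[k+1] n k))) ⟩
  1 + ∑ (suc n) (λ k → (n C k) + (n C suc k))                   ≡⟨ cong (1 +_) (∑-+ (suc n) _ _) ⟩
  1 + (∑ (suc n) (n C_) + ∑ (suc n) (λ k → n C suc k))          ≡⟨ r (∑ (suc n) (n C_)) _ ⟩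
  ∑ (suc n) (n C_) + (1 + ∑ (suc n) (λ k → n C suc k))
    ≡⟨ cong (∑ (suc n) (n C_) +_) (∑-split 1 (suc n) (n C_)) ⟨
  ∑ (suc n) (n C_) + (∑ (suc n) (n C_) + (n C suc n))
    ≡⟨ cong (λ x → ∑ (suc n) (n C_) + (∑ (suc n) (n C_) + x)) (k>n⇒nCk≡0 (n<1+n n)) ⟩
  ∑ (suc n) (n C_) + (∑ (suc n) (n C_) + 0)
    ≡⟨ cong (λ x → x + (x + 0)) (∑-binomial n) ⟩
  2 ^ suc n ∎
  where
  open ≡-Reasoning
  r : ∀ a b → 1 + (a + b) ≡ a + (1 + b)
  r = solve-∀

-- Each of the n + 1 numbers (n + 1) C(n, k) divides L and so is at most L, while together they sum
-- to (n + 1) 2^n.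
commonMultiple≥ : ∀ n L → 1 ≤ L → CommonMultiple (suc n) L → 2 ^ n ≤ L
commonMultiple≥ n L@(suc _) 1≤L cm = *-cancelˡ-≤ (suc n) (begin
  suc n * 2 ^ n                        ≡⟨ cong (suc n *_) (∑-binomial n) ⟨
  suc n * ∑ (suc n) (n C_)             ≡⟨ ∑-*ˡ (suc n) (suc n) (n C_) ⟨
  ∑ (suc n) (λ k → suc n * (n C k))    ≤⟨ ∑-mono (suc n) (λ k k<1+n → ∣⇒≤ (leibniz n k (s≤s⁻¹ k<1+n) cm)) ⟩
  ∑ (suc n) (λ _ → L)                  ≡⟨ ∑-const (suc n) L ⟩
  suc n * L                            ∎)
  where open ≤-Reasoning

nCk≤2^n : ∀ n k → n C k ≤ 2 ^ n
nCk≤2^n zero    zero    = ≤-refl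
nCk≤2^n zero    (suc k) = z≤n
nCk≤2^n (suc n) zero    = m^n>0 2 (suc n)
nCk≤2^n (suc n) (suc k) = begin
  suc n C suc k            ≡⟨ nCk+nC[k+1]≡[n+1]C[k+1] n k ⟨
  (n C k) + (n C suc k)    ≤⟨ +-mono-≤ (nCk≤2^n n k) (nCk≤2^n n (suc k)) ⟩
  2 ^ n + 2 ^ n            ≡⟨ cong (2 ^ n +_) (+-identityʳ (2 ^ n)) ⟨
  2 ^ suc n                ∎
  where open ≤-Reasoning

prime∣!⇒≤ : ∀ {p} n → Prime p → p ∣ n ! → p ≤ n
prime∣!⇒≤ {p} zero pp p∣1 = contradiction (subst Prime (∣1⇒≡1 p∣1) pp) ¬prime[1]
prime∣!⇒≤ (suc n) pp p∣ with euclidsLemma (suc n) (n !) pp p∣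
... | inj₁ p∣n = ∣⇒≤ p∣n
... | inj₂ p∣n! = m≤n⇒m≤1+n (prime∣!⇒≤ n pp p∣n!)

n∣n! : ∀ n → 1 ≤ n → n ∣ n !
n∣n! (suc n) _ = m∣m*n (n !)

central : ℕ → ℕ
central m = (m + m) C m

central-! : ∀ m → central m * (m ! * m !) ≡ (m + m) !
central-! m = begin
  central m * (m ! * m !)
    ≡⟨ cong (λ x → central m * (m ! * x !)) (m+n∸m≡n m m) ⟨
  central m * (m ! * (m + m ∸ m) !)
    ≡⟨ cong (_* (m ! * (m + m ∸ m) !)) (nCk≡n!/k![n-k]! (m≤m+n m m)) ⟩
  ((m + m) ! / (m ! * (m + m ∸ m) !)) * (m ! * (m + m ∸ m) !)
    ≡⟨ m/n*n≡m (k![n∸k]!∣n! (m≤m+n m m)) ⟩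
  (m + m) ! ∎
  where
  open ≡-Reasoning
  instance _ = m !* (m + m ∸ m) !≢0

-- The prime p divides (2m)!, but it exceeds m and so divides neither factor m!. Thus `central m`,
-- at most 2^(2m), can stand for the product of these primes.
prime∣central : ∀ {m p} → Prime p → m < p → p ≤ m + m → p ∣ central m
prime∣central {m} {p} pp m<p p≤2m
  with euclidsLemma (central m) (m ! * m !) pp
         (subst (p ∣_) (sym (central-! m)) (∣-trans (n∣n! p (≤-trans (s≤s z≤n) m<p)) (m≤n⇒m!∣n! p≤2m)))
... | inj₁ p∣C = p∣C
... | inj₂ p∣m!m! with euclidsLemma (m !) (m !) pp p∣m!m!
...   | inj₁ p∣m! = contradiction (prime∣!⇒≤ m pp p∣m!) (<⇒≱ m<p)
...   | inj₂ p∣m! = contradiction (prime∣!⇒≤ m pp p∣m!) (<⇒≱ m<p)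

1≤central : ∀ m → 1 ≤ central m
1≤central m with central m | central-! m
... | zero  | e = contradiction e (<⇒≢ (1≤n! (m + m)))
... | suc _ | _ = s≤s z≤n

-- A composite j = a b ≤ 2m has one factor at most √(2m) ≤ s and the other at most m.
doubling : ∀ {m L} s X → 1 ≤ m → m + m ≤ s * s → (∀ {p} → Prime p → m < p → p ≤ m + m → p ∣ X) →
           CommonMultiple m L → CommonMultiple (m + m) (X * (s ! * L))
doubling {m} {L} s X 1≤m 2m≤s² primes cm j 1≤j j≤2m with j ≤? m
... | yes j≤m = ∣n⇒∣m*n X (∣n⇒∣m*n (s !) (cm j 1≤j j≤m))
... | no j≰m with prime? j
...   | yes pj = ∣m⇒∣m*n _ (primes pj (≰⇒> j≰m) j≤2m)
...   | no ¬pj with ¬prime⇒composite {{n>1⇒nonTrivial (≤-trans (s≤s 1≤m) (≰⇒> j≰m))}} ¬pj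
...     | hasNonTrivialDivisor {b} b<j (divides a j≡ab) = ∣n⇒∣m*n X (go (≤-total a b))
  where
  1<b : 1 < b
  1<b = nonTrivial⇒n>1 b
  1<a : 1 < a
  1<a = ≰⇒> λ a≤1 → <⇒≱ b<j (≤-trans (≤-reflexive j≡ab) (≤-trans (*-monoˡ-≤ b a≤1) (≤-reflexive (*-identityˡ b))))
  halve : ∀ {x y} → j ≡ x * y → 1 < x → y ≤ m
  halve {x} {y} e 1<x = ≮⇒≥ λ m<y → <⇒≱ (+-mono-< m<y m<y) (begin
    y + y   ≡⟨ cong (y +_) (+-identityʳ y) ⟨
    2 * y   ≤⟨ *-monoˡ-≤ y 1<x ⟩
    x * y   ≡⟨ e ⟨
    j       ≤⟨ j≤2m ⟩
    m + m   ∎)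
    where open ≤-Reasoning
  root : ∀ {x y} → j ≡ x * y → x ≤ y → x ≤ s
  root {x} {y} e x≤y = ≮⇒≥ λ s<x → <⇒≱ (*-mono-< s<x s<x) (begin
    x * x   ≤⟨ *-monoʳ-≤ x x≤y ⟩
    x * y   ≡⟨ e ⟨
    j       ≤⟨ j≤2m ⟩
    m + m   ≤⟨ 2m≤s² ⟩
    s * s   ∎)
    where open ≤-Reasoning
  small : ∀ {x} → 1 < x → x ≤ s → x ∣ s !
  small {x} 1<x x≤s = ∣-trans (n∣n! x (<⇒≤ 1<x)) (m≤n⇒m!∣n! x≤s)
  j≡ba : j ≡ b * a
  j≡ba = trans j≡ab (*-comm a b)
  go : a ≤ b ⊎ b ≤ a → j ∣ s ! * L
  go (inj₁ a≤b) = subst (_∣ s ! * L) (sym j≡ab)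
    (*-pres-∣ (small 1<a (root j≡ab a≤b)) (cm b (<⇒≤ 1<b) (halve j≡ab 1<a)))
  go (inj₂ b≤a) = subst (_∣ s ! * L) (sym j≡ba)
    (*-pres-∣ (small 1<b (root j≡ba b≤a)) (cm a (<⇒≤ 1<a) (halve j≡ba 1<b)))

!≤^ : ∀ n k → k ≤ n → k ! ≤ n ^ k
!≤^ n zero    _   = ≤-refl
!≤^ n (suc k) k<n = *-mono-≤ k<n (!≤^ n k (<⇒≤ k<n))

[2^i]!≤ : ∀ i → (2 ^ i) ! ≤ 2 ^ (i * 2 ^ i)
[2^i]!≤ i = ≤-trans (!≤^ (2 ^ i) (2 ^ i) ≤-refl) (≤-reflexive (^-*-assoc 2 i (2 ^ i)))

4^i≡2^i*2^i : ∀ i → 4 ^ i ≡ 2 ^ i * 2 ^ i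
4^i≡2^i*2^i zero    = refl
4^i≡2^i*2^i (suc i) = trans (cong (4 *_) (4^i≡2^i*2^i i)) (r (2 ^ i))
  where
  r : ∀ q → 4 * (q * q) ≡ 2 * q * (2 * q)
  r = solve-∀

-- Two doublings. Working with powers of 4 makes 4 · 4^i the exact square of 2^(i + 1), which bounds
-- the smaller factor of a composite in both. `X` and `Y` stay open because they are central
-- binomial coefficients in the upper bound and 1 in a range without primes.
quadrupling : ∀ {L} i X Y →
  (∀ {p} → Prime p → 4 ^ i < p → p ≤ 4 ^ i + 4 ^ i → p ∣ X) →
  (∀ {p} → Prime p → 4 ^ i + 4 ^ i < p → p ≤ (4 ^ i + 4 ^ i) + (4 ^ i + 4 ^ i) → p ∣ Y) →
  CommonMultiple (4 ^ i) L →
  CommonMultiple (4 ^ suc i) (Y * ((2 ^ suc i) ! * (X * ((2 ^ suc i) ! * L))))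
quadrupling {L} i X Y hX hY cm =
  subst (λ n → CommonMultiple n (Y * ((2 ^ suc i) ! * (X * ((2 ^ suc i) ! * L))))) (r (4 ^ i))
    (doubling (2 ^ suc i) Y (≤-trans 1≤m (m≤m+n m m)) (≤-reflexive 4m≡s²) hY
      (doubling (2 ^ suc i) X 1≤m (≤-trans (m≤m+n (m + m) (m + m)) (≤-reflexive 4m≡s²)) hX cm))
  where
  m = 4 ^ i
  1≤m : 1 ≤ m
  1≤m = m^n>0 4 i
  r : ∀ m → (m + m) + (m + m) ≡ 4 * m
  r = solve-∀
  4m≡s² : (m + m) + (m + m) ≡ 2 ^ suc i * 2 ^ suc i
  4m≡s² = trans (r m) (4^i≡2^i*2^i (suc i))

i<2^i : ∀ i → i < 2 ^ i
i<2^i zero    = ≤-refl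
i<2^i (suc i) = +-mono-≤ (m^n>0 2 i) (≤-trans (i<2^i i) (≤-reflexive (sym (+-identityʳ (2 ^ i)))))

^-collect : ∀ a b c d e → 2 ^ a * (2 ^ b * (2 ^ c * (2 ^ d * 2 ^ e))) ≡ 2 ^ (a + (b + (c + (d + e))))
^-collect a b c d e
  rewrite ^-distribˡ-+-* 2 a (b + (c + (d + e))) | ^-distribˡ-+-* 2 b (c + (d + e))
        | ^-distribˡ-+-* 2 c (d + e) | ^-distribˡ-+-* 2 d e = refl

-- The exponent 4 reproduces itself. With m = 4^i, the two binomial coefficients cost 2m + 4m, the
-- two factorials at most 2m each and the previous multiple 4m: 14m in all, within 4 · 4m.
smallCommonMultiple : ∀ i → ∃[ L ] (CommonMultiple (4 ^ i) L × 1 ≤ L × L ≤ 2 ^ (4 * 4 ^ i))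
smallCommonMultiple zero = 1 , (λ j 1≤j j≤1 → subst (_∣ 1) (≤-antisym 1≤j j≤1) ∣-refl) , ≤-refl , s≤s z≤n
smallCommonMultiple (suc i) with smallCommonMultiple i
... | L , cm , 1≤L , L≤ =
  central (m + m) * (s ! * (central m * (s ! * L))) ,
  quadrupling i (central m) (central (m + m)) prime∣central prime∣central cm ,
  *-mono-≤ (1≤central (m + m)) (*-mono-≤ (1≤n! s) (*-mono-≤ (1≤central m) (*-mono-≤ (1≤n! s) 1≤L))) ,
  bound
  where
  open ≤-Reasoning
  m = 4 ^ i
  s = 2 ^ suc i
  e = suc i * 2 ^ suc i
  e≤2m : e ≤ m + m
  e≤2m = begin
    suc i * (2 * 2 ^ i)      ≤⟨ *-monoˡ-≤ (2 * 2 ^ i) (i<2^i i) ⟩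
    2 ^ i * (2 * 2 ^ i)      ≡⟨ r (2 ^ i) ⟩
    2 ^ i * 2 ^ i + 2 ^ i * 2 ^ i  ≡⟨ cong (λ x → x + x) (4^i≡2^i*2^i i) ⟨
    m + m                    ∎
    where
    r : ∀ q → q * (2 * q) ≡ q * q + q * q
    r = solve-∀
  s!≤ : s ! ≤ 2 ^ (m + m)
  s!≤ = ≤-trans ([2^i]!≤ (suc i)) (^-monoʳ-≤ 2 e≤2m)
  bound : central (m + m) * (s ! * (central m * (s ! * L))) ≤ 2 ^ (4 * (4 * m))
  bound = begin
    central (m + m) * (s ! * (central m * (s ! * L)))
      ≤⟨ *-mono-≤ (nCk≤2^n (m + m + (m + m)) (m + m)) (*-mono-≤ s!≤ (*-mono-≤ (nCk≤2^n (m + m) m) (*-mono-≤ s!≤ L≤))) ⟩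
    2 ^ (m + m + (m + m)) * (2 ^ (m + m) * (2 ^ (m + m) * (2 ^ (m + m) * 2 ^ (4 * m))))
      ≡⟨ ^-collect (m + m + (m + m)) (m + m) (m + m) (m + m) (4 * m) ⟩
    2 ^ (m + m + (m + m) + ((m + m) + ((m + m) + ((m + m) + 4 * m))))
      ≤⟨ ^-monoʳ-≤ 2 (≤-trans (m≤m+n (m + m + (m + m) + ((m + m) + ((m + m) + ((m + m) + 4 * m)))) (2 * m)) (≤-reflexive (r m))) ⟩
    2 ^ (4 * (4 * m)) ∎
    where
    r : ∀ m → m + m + (m + m) + ((m + m) + ((m + m) + ((m + m) + 4 * m))) + 2 * m ≡ 4 * (4 * m)
    r = solve-∀

-- Room for the factorials in `weakBertrand`: after division by 2^i they cost 12i + 20 in the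
-- exponent, and 15 · 4^i - 4 · 4^i leaves 11 · 2^i.
exponentBound : ∀ k → 12 * (3 + k) + 20 ≤ 11 * 2 ^ (3 + k)
exponentBound zero    = from-yes (56 ≤? 88)
exponentBound (suc k) = begin
  12 * (3 + suc k) + 20            ≡⟨ r k ⟩
  12 * (3 + k) + 20 + 12           ≤⟨ +-mono-≤ (exponentBound k) (≤-trans (from-yes (12 ≤? 88))
                                        (*-monoʳ-≤ 11 (^-monoʳ-≤ 2 (m≤m+n 3 k)))) ⟩
  11 * 2 ^ (3 + k) + 11 * 2 ^ (3 + k)   ≡⟨ r′ (2 ^ (3 + k)) ⟩
  11 * 2 ^ (3 + suc k) ∎
  where
  open ≤-Reasoning
  r : ∀ k → 12 * (3 + suc k) + 20 ≡ 12 * (3 + k) + 20 + 12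
  r = solve-∀
  r′ : ∀ q → 11 * q + 11 * q ≡ 11 * (2 * q)
  r′ = solve-∀

-- Without primes in (4ⁱ, 4ⁱ⁺²], some common multiple of 1, …, 4ⁱ⁺² is at most 2^(15·4ⁱ), against the lower
-- bound 2^(16·4ⁱ − 1).
weakBertrand : ∀ i → 3 ≤ i → ∃[ p ] (Prime p × 4 ^ i < p × p ≤ 16 * 4 ^ i)
weakBertrand i 3≤i with anyUpTo? (λ p → prime? p ×-dec (4 ^ i <? p)) (suc (16 * 4 ^ i))
... | yes (p , p<1+16m , pp , m<p) = p , pp , m<p , s≤s⁻¹ p<1+16m
... | no ¬prime with smallCommonMultiple i
...   | L , cm , 1≤L , L≤ = contradiction (≤-trans lower upper) (<⇒≱ 2^<)
  where
  open ≤-Reasoning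
  m = 4 ^ i
  s = 2 ^ suc i
  t = 2 ^ suc (suc i)
  -- The factors 1 take the place of the central binomial coefficients: with no primes in the range,
  -- the divisibility required of them is vacuous.
  L′ = 1 * (s ! * (1 * (s ! * L)))
  L″ = 1 * (t ! * (1 * (t ! * L′)))
  none : ∀ {p X} → Prime p → m < p → p ≤ 16 * m → p ∣ X
  none {p} pp m<p p≤ = contradiction (p , s≤s p≤ , pp , m<p) ¬prime
  2m≤16m : m + m ≤ 16 * m
  2m≤16m = ≤-trans (m≤m+n (m + m) (14 * m)) (≤-reflexive (r m))
    where
    r : ∀ m → m + m + 14 * m ≡ 16 * m
    r = solve-∀
  4m≤16m : m + m + (m + m) ≤ 16 * m
  4m≤16m = ≤-trans (m≤m+n (m + m + (m + m)) (12 * m)) (≤-reflexive (r m))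
    where
    r : ∀ m → m + m + (m + m) + 12 * m ≡ 16 * m
    r = solve-∀
  8m≤16m : 4 * m + 4 * m ≤ 16 * m
  8m≤16m = ≤-trans (m≤m+n (4 * m + 4 * m) (8 * m)) (≤-reflexive (r m))
    where
    r : ∀ m → 4 * m + 4 * m + 8 * m ≡ 16 * m
    r = solve-∀
  16m≡ : (4 * m + 4 * m) + (4 * m + 4 * m) ≡ 16 * m
  16m≡ = r m
    where
    r : ∀ m → (4 * m + 4 * m) + (4 * m + 4 * m) ≡ 16 * m
    r = solve-∀
  m≤4m : m ≤ 4 * m
  m≤4m = m≤m+n m _
  cm′ : CommonMultiple (4 ^ suc i) L′
  cm′ = quadrupling i 1 1 (λ pp l u → none pp l (≤-trans u 2m≤16m))
                          (λ pp l u → none pp (≤-<-trans (m≤m+n m m) l) (≤-trans u 4m≤16m)) cm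
  cm″ : CommonMultiple (4 ^ suc (suc i)) L″
  cm″ = quadrupling (suc i) 1 1 (λ pp l u → none pp (≤-<-trans m≤4m l) (≤-trans u 8m≤16m))
          (λ pp l u → none pp (≤-<-trans (≤-trans m≤4m (m≤m+n (4 * m) _)) l) (≤-trans u (≤-reflexive 16m≡))) cm′
  1≤L″ : 1 ≤ L″
  1≤L″ = *-mono-≤ (≤-refl {1}) (*-mono-≤ (1≤n! t) (*-mono-≤ (≤-refl {1}) (*-mono-≤ (1≤n! t)
          (*-mono-≤ (≤-refl {1}) (*-mono-≤ (1≤n! s) (*-mono-≤ (≤-refl {1}) (*-mono-≤ (1≤n! s) 1≤L)))))))
  exponent : suc (suc i) * t + (suc (suc i) * t + (suc i * s + (suc i * s + 4 * m))) ≤ 15 * m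
  exponent = begin
    suc (suc i) * t + (suc (suc i) * t + (suc i * s + (suc i * s + 4 * m)))  ≡⟨ r i (2 ^ i) m ⟩
    (12 * i + 20) * 2 ^ i + 4 * m     ≤⟨ +-monoˡ-≤ (4 * m) (*-monoˡ-≤ (2 ^ i) i-bound) ⟩
    11 * 2 ^ i * 2 ^ i + 4 * m        ≡⟨ cong (_+ 4 * m) (*-assoc 11 (2 ^ i) (2 ^ i)) ⟩
    11 * (2 ^ i * 2 ^ i) + 4 * m      ≡⟨ cong (λ x → 11 * x + 4 * m) (4^i≡2^i*2^i i) ⟨
    11 * m + 4 * m                    ≡⟨ *-distribʳ-+ m 11 4 ⟨
    15 * m ∎
    where
    r : ∀ i q m → suc (suc i) * (2 * (2 * q)) + (suc (suc i) * (2 * (2 * q)) + (suc i * (2 * q) + (suc i * (2 * q) + 4 * m)))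
                  ≡ (12 * i + 20) * q + 4 * m
    r = solve-∀
    i-bound : 12 * i + 20 ≤ 11 * 2 ^ i
    i-bound = subst (λ i → 12 * i + 20 ≤ 11 * 2 ^ i) (m+[n∸m]≡n 3≤i) (exponentBound (i ∸ 3))
  upper : L″ ≤ 2 ^ (15 * m)
  upper = begin
    L″ ≡⟨ r (t !) (s !) L ⟩
    t ! * (t ! * (s ! * (s ! * L)))
      ≤⟨ *-mono-≤ ([2^i]!≤ (suc (suc i))) (*-mono-≤ ([2^i]!≤ (suc (suc i)))
           (*-mono-≤ ([2^i]!≤ (suc i)) (*-mono-≤ ([2^i]!≤ (suc i)) L≤))) ⟩
    2 ^ (suc (suc i) * t) * (2 ^ (suc (suc i) * t) * (2 ^ (suc i * s) * (2 ^ (suc i * s) * 2 ^ (4 * m))))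
      ≡⟨ ^-collect (suc (suc i) * t) (suc (suc i) * t) (suc i * s) (suc i * s) (4 * m) ⟩
    2 ^ (suc (suc i) * t + (suc (suc i) * t + (suc i * s + (suc i * s + 4 * m))))
      ≤⟨ ^-monoʳ-≤ 2 exponent ⟩
    2 ^ (15 * m) ∎
    where
    r : ∀ a b c → 1 * (a * (1 * (a * (1 * (b * (1 * (b * c))))))) ≡ a * (a * (b * (b * c)))
    r = solve-∀
  2≤m : 2 ≤ m
  2≤m = ≤-trans (from-yes (2 ≤? 64)) (^-monoʳ-≤ 4 3≤i)
  -- One unit is split off because a common multiple of 1, ..., n + 1 is only known to be at least
  -- 2^n; the contradiction survives as `pred m` is still positive.
  size : 4 ^ suc (suc i) ≡ suc (15 * m + pred m)
  size = begin-equality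
    4 * (4 * m)               ≡⟨ r m ⟩
    15 * m + m                ≡⟨ cong (15 * m +_) (suc-pred m {{>-nonZero (≤-trans (s≤s z≤n) 2≤m)}}) ⟨
    15 * m + suc (pred m)     ≡⟨ +-suc (15 * m) (pred m) ⟩
    suc (15 * m + pred m)     ∎
    where
    r : ∀ m → 4 * (4 * m) ≡ 15 * m + m
    r = solve-∀
  lower : 2 ^ (15 * m + pred m) ≤ L″
  lower = commonMultiple≥ (15 * m + pred m) L″ 1≤L″ (subst (λ n → CommonMultiple n L″) size cm″)
  2^< : 2 ^ (15 * m) < 2 ^ (15 * m + pred m)
  2^< = ^-monoʳ-< 2 ≤-refl (≤-trans (≤-reflexive (+-comm 1 (15 * m))) (+-monoʳ-≤ (15 * m) (pred-mono-≤ 2≤m)))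

-- This supplies the modulus q, which may be arbitrarily large since the cell width is chosen in
-- proportion to it.
largePrime : ∀ N → ∃[ q ] (Prime q × N ≤ q)
largePrime N with weakBertrand (3 + N) (m≤m+n 3 N)
... | q , pq , 4^<q , _ = q , pq , (begin
  N            ≤⟨ m≤n+m N 3 ⟩
  3 + N        ≤⟨ <⇒≤ (i<2^i (3 + N)) ⟩
  2 ^ (3 + N)  ≤⟨ ^-monoˡ-≤ (3 + N) (from-yes (2 ≤? 4)) ⟩
  4 ^ (3 + N)  ≤⟨ <⇒≤ 4^<q ⟩
  q            ∎)
  where open ≤-Reasoning

-- The descent through the powers of 16 ends either when the next lower power is below m, at the
-- cost of a factor 16, or at 16³, at the cost of a factor 16³. The latter dictates the condition on
-- `b`.
scale : ∀ b → 16 ^ 3 ≤ b → ∀ m → 1 ≤ m → ∀ j → m ≤ 16 ^ (3 + j) → ∃[ i ] (3 ≤ i × m ≤ 16 ^ i × 16 ^ i ≤ b * m)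
scale b 16³≤b m 1≤m zero    m≤ = 3 , ≤-refl , m≤ ,
  ≤-trans 16³≤b (≤-trans (≤-reflexive (sym (*-identityʳ b))) (*-monoʳ-≤ b 1≤m))
scale b 16³≤b m 1≤m (suc j) m≤ with m ≤? 16 ^ (3 + j)
... | yes m≤′ = scale b 16³≤b m 1≤m j m≤′
... | no  m≰  = 4 + j , s≤s (s≤s (s≤s z≤n)) , m≤ ,
  ≤-trans (*-monoʳ-≤ 16 (<⇒≤ (≰⇒> m≰))) (*-monoˡ-≤ m (≤-trans (from-yes (16 ≤? 16 ^ 3)) 16³≤b))

16^i≡4^i*4^i : ∀ i → 16 ^ i ≡ 4 ^ i * 4 ^ i
16^i≡4^i*4^i zero    = refl
16^i≡4^i*4^i (suc i) = trans (cong (16 *_) (16^i≡4^i*4^i i)) (r (4 ^ i))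
  where
  r : ∀ q → 16 * (q * q) ≡ 4 * q * (4 * q)
  r = solve-∀

-- The bound m ≤ p² will make coincidences in a cell rare, and p² ≤ K m will make the number of
-- cells hit, at least m/(128p), of order √m. The constant: p ≤ 16 · 4^i gives p² ≤ 16² · 16^i, and
-- 16^i ≤ 16³ m.
primeNear√ : ∃[ K ] (∀ m → 1 ≤ m → ∃[ p ] (Prime p × 2 < p × m ≤ p * p × p * p ≤ K * m))
primeNear√ = 16 * 16 * 16 ^ 3 , near (16 ^ 3) (16 * 16 * 16 ^ 3) ≤-refl refl
  where
  square-bound : ∀ a b {p q n m} → p ≤ a * q → n ≡ q * q → n ≤ b * m → p * p ≤ a * a * b * m
  square-bound a b {p} {q} {n} {m} p≤ n≡ n≤ = begin
    p * p                ≤⟨ *-mono-≤ p≤ p≤ ⟩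
    a * q * (a * q)      ≡⟨ r a q ⟩
    a * a * (q * q)      ≡⟨ cong (a * a *_) n≡ ⟨
    a * a * n            ≤⟨ *-monoʳ-≤ (a * a) n≤ ⟩
    a * a * (b * m)      ≡⟨ *-assoc (a * a) b m ⟨
    a * a * b * m        ∎
    where
    open ≤-Reasoning
    r : ∀ a q → a * q * (a * q) ≡ a * a * (q * q)
    r = solve-∀
  near : ∀ b K → 16 ^ 3 ≤ b → 16 * 16 * b ≡ K →
         ∀ m → 1 ≤ m → ∃[ p ] (Prime p × 2 < p × m ≤ p * p × p * p ≤ K * m)
  near b K 16³≤b K≡ m 1≤m with scale b 16³≤b m 1≤m m (≤-trans (<⇒≤ (i<2^i m))
                    (≤-trans (^-monoˡ-≤ m (from-yes (2 ≤? 16))) (^-monoʳ-≤ 16 (m≤n+m m 3))))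
  ... | i , 3≤i , m≤16^i , 16^i≤ with weakBertrand i 3≤i
  ...   | p , pp , 4^i<p , p≤ = p , pp ,
    <-trans (≤-trans (from-yes (3 ≤? 64)) (^-monoʳ-≤ 4 3≤i)) 4^i<p ,
    ≤-trans m≤16^i (≤-trans (≤-reflexive (16^i≡4^i*4^i i)) (*-mono-≤ (<⇒≤ 4^i<p) (<⇒≤ 4^i<p))) ,
    subst (λ k → p * p ≤ k * m) K≡ (square-bound 16 b {q = 4 ^ i} p≤ (16^i≡4^i*4^i i) 16^i≤)

-- Division with remainder and squares modulo a prime

private
  quotient-≤ : ∀ d x y {r r′} → r′ < d → d * x + r ≡ d * y + r′ → x ≤ y
  quotient-≤ d x y {r} {r′} r′<d e = ≮⇒≥ λ y<x → <⇒≢ (begin-strict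
    d * y + r′     <⟨ +-monoʳ-< (d * y) r′<d ⟩
    d * y + d      ≡⟨ +-comm (d * y) d ⟩
    d + d * y      ≡⟨ *-suc d y ⟨
    d * suc y      ≤⟨ *-monoʳ-≤ d y<x ⟩
    d * x          ≤⟨ m≤m+n (d * x) r ⟩
    d * x + r      ∎) (sym e)
    where open ≤-Reasoning

-- Used with base d = 2p for sums of two residues modulo p, and with d = 2w for sums of two offsets
-- inside cells; the doubled base is what rules out carries.
division-unique : ∀ d x y {r r′} → r < d → r′ < d → d * x + r ≡ d * y + r′ → x ≡ y × r ≡ r′
division-unique d x y {r} {r′} r<d r′<d e =
  x≡y , +-cancelˡ-≡ (d * x) r r′ (trans e (cong (λ z → d * z + r′) (sym x≡y)))
  where
  x≡y : x ≡ y
  x≡y = ≤-antisym (quotient-≤ d x y r′<d e) (quotient-≤ d y x r<d (sym e))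

∣∣-∣⇒≡ : ∀ {q} x y → x < q → y < q → q ∣ ∣ x - y ∣ → x ≡ y
∣∣-∣⇒≡ x y x<q y<q q∣ with ∣ x - y ∣ in eq
... | zero  = ∣m-n∣≡0⇒m≡n eq
... | suc _ = contradiction (∣⇒≤ q∣) (<⇒≱ (subst (_< _) eq (≤-<-trans (∣m-n∣≤m⊔n x y) (⊔-lub x<q y<q))))

abs-⊖ : ∀ i k → ℤ.∣ ℤ.+ i ℤ.- ℤ.+ k ∣ ≡ ∣ i - k ∣
abs-⊖ i k with ≤-total i k
... | inj₁ i≤k = trans (cong ℤ.∣_∣ (ℤ.m-n≡m⊖n i k)) (trans (ℤ.∣⊖∣-≤ i≤k) (sym (m≤n⇒∣m-n∣≡n∸m i≤k)))
... | inj₂ k≤i = trans (cong ℤ.∣_∣ (ℤ.m-n≡m⊖n i k)) (trans (cong ℤ.∣_∣ (ℤ.⊖-≥ k≤i)) (sym (m≤n⇒∣n-m∣≡n∸m k≤i)))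

-- The Erdős–Turán ruler.
mark : (p : ℕ) .{{_ : NonZero p}} → ℕ → ℕ
mark p i = (p + p) * i + (i * i) % p

mark< : ∀ p .{{_ : NonZero p}} i → i < p → mark p i < (p + p) * p
mark< p i i<p = begin-strict
  (p + p) * i + (i * i) % p    <⟨ +-monoʳ-< ((p + p) * i) (<-≤-trans (m%n<n (i * i) p) (m≤m+n p p)) ⟩
  (p + p) * i + (p + p)        ≡⟨ +-comm ((p + p) * i) (p + p) ⟩
  (p + p) + (p + p) * i        ≡⟨ *-suc (p + p) i ⟨
  (p + p) * suc i              ≤⟨ *-monoʳ-≤ (p + p) i<p ⟩
  (p + p) * p                  ∎
  where open ≤-Reasoning

-- Since two residues add up to less than 2p, the equation splits into i + l = k + j and i² + l² ≡
-- k² + j² modulo p. Eliminating l gives 2 (i - k)(i - j) ≡ 0, and the prime p > 2 divides one of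
-- the last two factors.
mark-sidon : ∀ p .{{_ : NonZero p}} → Prime p → 2 < p → ∀ {i j k l} → i < p → j < p → k < p → l < p →
             mark p i + mark p l ≡ mark p k + mark p j → (i ≡ k × l ≡ j) ⊎ (i ≡ j × l ≡ k)
mark-sidon p pp 2<p {i} {j} {k} {l} i<p j<p k<p l<p e = conclude
  where
  R : ℕ → ℕ
  R x = (x * x) % p
  D : ℕ → ℕ
  D x = (x * x) / p
  split : i + l ≡ k + j × R i + R l ≡ R k + R j
  split = division-unique (p + p) (i + l) (k + j)
    (+-mono-< (m%n<n (i * i) p) (m%n<n (l * l) p)) (+-mono-< (m%n<n (k * k) p) (m%n<n (j * j) p))
    (trans (regroup (p + p) i l (R i) (R l)) (trans e (sym (regroup (p + p) k j (R k) (R j)))))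
    where
    regroup : ∀ d i l r s → d * (i + l) + (r + s) ≡ (d * i + r) + (d * l + s)
    regroup = solve-∀
  -- The congruence of the sums of squares, with the quotients by p moved across so that it is an
  -- equation in ℕ.
  squares : i * i + l * l + (D k + D j) * p ≡ k * k + j * j + (D i + D l) * p
  squares = begin
    i * i + l * l + (D k + D j) * p
      ≡⟨ cong₂ (λ x y → x + y + (D k + D j) * p) (m≡m%n+[m/n]*n (i * i) p) (m≡m%n+[m/n]*n (l * l) p) ⟩
    (R i + D i * p) + (R l + D l * p) + (D k + D j) * p
      ≡⟨ regroup (R i) (R l) (D i) (D l) (D k) (D j) p ⟩
    (R i + R l) + (D i + D l + D k + D j) * p
      ≡⟨ cong (_+ (D i + D l + D k + D j) * p) (proj₂ split) ⟩
    (R k + R j) + (D i + D l + D k + D j) * p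
      ≡⟨ regroup′ (R k) (R j) (D i) (D l) (D k) (D j) p ⟩
    (R k + D k * p) + (R j + D j * p) + (D i + D l) * p
      ≡⟨ cong₂ (λ x y → x + y + (D i + D l) * p) (m≡m%n+[m/n]*n (k * k) p) (m≡m%n+[m/n]*n (j * j) p) ⟨
    k * k + j * j + (D i + D l) * p ∎
    where
    open ≡-Reasoning
    regroup : ∀ a b c d e f p → (a + c * p) + (b + d * p) + (e + f) * p ≡ (a + b) + (c + d + e + f) * p
    regroup = solve-∀
    regroup′ : ∀ a b c d e f p → (a + b) + (c + d + e + f) * p ≡ (a + e * p) + (b + f * p) + (c + d) * p
    regroup′ = solve-∀
  I = ℤ.+ i
  J = ℤ.+ j
  K = ℤ.+ k
  Z : ℕ → ℕ → ℤ.ℤ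
  Z x y = ℤ.+ (D x + D y)
  L = ℤ.+ l
  P = ℤ.+ p
  factored : ℤ.+ 2 ℤ.* ((I ℤ.- K) ℤ.* (I ℤ.- J)) ≡ (Z i l ℤ.- Z k j) ℤ.* P
  factored = begin
    ℤ.+ 2 ℤ.* ((I ℤ.- K) ℤ.* (I ℤ.- J))
      ≡⟨ expand I J K ⟩
    I ℤ.* I ℤ.+ (K ℤ.+ J ℤ.- I) ℤ.* (K ℤ.+ J ℤ.- I) ℤ.- (K ℤ.* K ℤ.+ J ℤ.* J)
      ≡⟨ cong (λ x → I ℤ.* I ℤ.+ x ℤ.* x ℤ.- (K ℤ.* K ℤ.+ J ℤ.* J)) L≡ ⟨
    I ℤ.* I ℤ.+ L ℤ.* L ℤ.- (K ℤ.* K ℤ.+ J ℤ.* J)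
      ≡⟨ move (I ℤ.* I ℤ.+ L ℤ.* L) (Z k j) (K ℤ.* K ℤ.+ J ℤ.* J) P ⟩
    (I ℤ.* I ℤ.+ L ℤ.* L ℤ.+ Z k j ℤ.* P) ℤ.- (K ℤ.* K ℤ.+ J ℤ.* J) ℤ.- Z k j ℤ.* P
      ≡⟨ cong (λ x → x ℤ.- (K ℤ.* K ℤ.+ J ℤ.* J) ℤ.- Z k j ℤ.* P) squaresℤ ⟩
    (K ℤ.* K ℤ.+ J ℤ.* J ℤ.+ Z i l ℤ.* P) ℤ.- (K ℤ.* K ℤ.+ J ℤ.* J) ℤ.- Z k j ℤ.* P
      ≡⟨ cancel (K ℤ.* K ℤ.+ J ℤ.* J) (Z i l) (Z k j) P ⟩
    (Z i l ℤ.- Z k j) ℤ.* P ∎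
    where
    open ≡-Reasoning
    expand : ∀ I J K → ℤ.+ 2 ℤ.* ((I ℤ.- K) ℤ.* (I ℤ.- J)) ≡
             I ℤ.* I ℤ.+ (K ℤ.+ J ℤ.- I) ℤ.* (K ℤ.+ J ℤ.- I) ℤ.- (K ℤ.* K ℤ.+ J ℤ.* J)
    expand = ℤ-Solver.solve-∀
    move : ∀ S Z T P → S ℤ.- T ≡ (S ℤ.+ Z ℤ.* P) ℤ.- T ℤ.- Z ℤ.* P
    move = ℤ-Solver.solve-∀
    cancel : ∀ T Y Z P → (T ℤ.+ Y ℤ.* P) ℤ.- T ℤ.- Z ℤ.* P ≡ (Y ℤ.- Z) ℤ.* P
    cancel = ℤ-Solver.solve-∀
    subtract : ∀ I L → L ≡ I ℤ.+ L ℤ.- I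
    subtract = ℤ-Solver.solve-∀
    L≡ : L ≡ K ℤ.+ J ℤ.- I
    L≡ = trans (subtract I L) (cong (λ x → ℤ.+ x ℤ.- I) (proj₁ split))
    lift : ∀ x y z → ℤ.+ (x * x + y * y + z * p) ≡ ℤ.+ x ℤ.* ℤ.+ x ℤ.+ ℤ.+ y ℤ.* ℤ.+ y ℤ.+ ℤ.+ z ℤ.* P
    lift x y z = cong₂ ℤ._+_ (cong₂ ℤ._+_ (ℤ.pos-* x x) (ℤ.pos-* y y)) (ℤ.pos-* z p)
    squaresℤ : I ℤ.* I ℤ.+ L ℤ.* L ℤ.+ Z k j ℤ.* P ≡ K ℤ.* K ℤ.+ J ℤ.* J ℤ.+ Z i l ℤ.* P
    squaresℤ = trans (sym (lift i l (D k + D j))) (trans (cong ℤ.+_ squares) (lift k j (D i + D l)))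
  p∣ : p ∣ 2 * (∣ i - k ∣ * ∣ i - j ∣)
  p∣ = divides ℤ.∣ Z i l ℤ.- Z k j ∣ (begin
    2 * (∣ i - k ∣ * ∣ i - j ∣)
      ≡⟨ cong₂ (λ x y → 2 * (x * y)) (abs-⊖ i k) (abs-⊖ i j) ⟨
    2 * (ℤ.∣ I ℤ.- K ∣ * ℤ.∣ I ℤ.- J ∣)
      ≡⟨ cong (2 *_) (ℤ.abs-* (I ℤ.- K) (I ℤ.- J)) ⟨
    2 * ℤ.∣ (I ℤ.- K) ℤ.* (I ℤ.- J) ∣
      ≡⟨ ℤ.abs-* (ℤ.+ 2) ((I ℤ.- K) ℤ.* (I ℤ.- J)) ⟨
    ℤ.∣ ℤ.+ 2 ℤ.* ((I ℤ.- K) ℤ.* (I ℤ.- J)) ∣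
      ≡⟨ cong ℤ.∣_∣ factored ⟩
    ℤ.∣ (Z i l ℤ.- Z k j) ℤ.* P ∣
      ≡⟨ ℤ.abs-* (Z i l ℤ.- Z k j) P ⟩
    ℤ.∣ Z i l ℤ.- Z k j ∣ * p ∎)
    where open ≡-Reasoning
  conclude : (i ≡ k × l ≡ j) ⊎ (i ≡ j × l ≡ k)
  conclude with euclidsLemma 2 _ pp p∣
  ... | inj₁ p∣2 = contradiction (∣⇒≤ p∣2) (<⇒≱ 2<p)
  ... | inj₂ p∣ab with euclidsLemma ∣ i - k ∣ ∣ i - j ∣ pp p∣ab
  ...   | inj₁ p∣i-k with refl ← ∣∣-∣⇒≡ i k i<p k<p p∣i-k = inj₁ (refl , +-cancelˡ-≡ i l j (proj₁ split))
  ...   | inj₂ p∣i-j with refl ← ∣∣-∣⇒≡ i j i<p j<p p∣i-j =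
            inj₂ (refl , +-cancelˡ-≡ i l k (trans (proj₁ split) (+-comm k i)))

-- Sidon subsets of sets of integers

window : ℕ → ℕ → ℕ → ℕ
window lo w v = 𝟙 ((lo ≤? v) ×-dec (v <? lo + w))

∑-window : ∀ {Q} lo w → lo + w ≤ Q → ∑ Q (window lo w) ≡ w
∑-window {Q} lo w lo+w≤Q = begin
  ∑ Q (window lo w)                ≡⟨ cong (λ q → ∑ q (window lo w)) (m+[n∸m]≡n lo+w≤Q) ⟨
  ∑ (lo + w + r) (window lo w)     ≡⟨ ∑-split (lo + w) r (window lo w) ⟩
  ∑ (lo + w) (window lo w) + ∑ r (λ i → window lo w (lo + w + i))
    ≡⟨ cong₂ _+_ (∑-split lo w (window lo w)) (∑-zero r above) ⟩
  ∑ lo (window lo w) + ∑ w (λ i → window lo w (lo + i)) + 0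
    ≡⟨ cong₂ (λ x y → x + y + 0) (∑-zero lo below) (∑-cong w inside) ⟩
  ∑ w (λ _ → 1) + 0                ≡⟨ +-identityʳ _ ⟩
  ∑ w (λ _ → 1)                    ≡⟨ ∑-const w 1 ⟩
  w * 1                            ≡⟨ *-identityʳ w ⟩
  w                                ∎
  where
  open ≡-Reasoning
  r = Q ∸ (lo + w)
  above : ∀ i → i < r → window lo w (lo + w + i) ≡ 0
  above i _ = 𝟙-no ((lo ≤? lo + w + i) ×-dec (lo + w + i <? lo + w)) λ (_ , h) → <⇒≱ h (m≤m+n (lo + w) i)
  below : ∀ i → i < lo → window lo w i ≡ 0
  below i i<lo = 𝟙-no ((lo ≤? i) ×-dec (i <? lo + w)) λ (h , _) → <⇒≱ i<lo h
  inside : ∀ i → i < w → window lo w (lo + i) ≡ 1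
  inside i i<w = 𝟙-yes ((lo ≤? lo + i) ×-dec (lo + i <? lo + w)) (m≤m+n lo i , +-monoʳ-< lo i<w)

-- Affine maps modulo a prime

∣-∣-from-% : ∀ q .{{_ : NonZero q}} x y → x % q ≡ y % q → q ∣ ∣ x - y ∣
∣-∣-from-% q x y e = divides ∣ x / q - y / q ∣ (begin
  ∣ x - y ∣
    ≡⟨ cong₂ ∣_-_∣ (m≡m%n+[m/n]*n x q) (trans (m≡m%n+[m/n]*n y q) (cong (_+ y / q * q) (sym e))) ⟩
  ∣ x % q + x / q * q - x % q + y / q * q ∣     ≡⟨ ∣m+n-m+o∣≡∣n-o∣ (x % q) _ _ ⟩
  ∣ x / q * q - y / q * q ∣                     ≡⟨ *-distribʳ-∣-∣ q (x / q) (y / q) ⟨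
  ∣ x / q - y / q ∣ * q                         ∎)
  where open ≡-Reasoning

%-shift-injective : ∀ q .{{_ : NonZero q}} c s t → s < q → t < q → (c + s) % q ≡ (c + t) % q → s ≡ t
%-shift-injective q c s t s<q t<q e =
  ∣∣-∣⇒≡ s t s<q t<q (subst (q ∣_) (∣m+n-m+o∣≡∣n-o∣ c s t) (∣-∣-from-% q (c + s) (c + t) e))

%-affine-injective : ∀ q .{{_ : NonZero q}} → Prime q → ∀ u h → 1 ≤ h → h < q → ∀ s t → s < q → t < q →
                     (u + s * h) % q ≡ (u + t * h) % q → s ≡ t
%-affine-injective q pq u h 1≤h h<q s t s<q t<q e
  with euclidsLemma ∣ s - t ∣ h pq (subst (q ∣_) (trans (∣m+n-m+o∣≡∣n-o∣ u (s * h) (t * h)) (sym (*-distribʳ-∣-∣ h s t)))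
                                       (∣-∣-from-% q (u + s * h) (u + t * h) e))
... | inj₁ q∣ = ∣∣-∣⇒≡ s t s<q t<q q∣
... | inj₂ q∣h = contradiction (∣⇒≤ {{>-nonZero 1≤h}} q∣h) (<⇒≱ h<q)

∑-shift-≤ : ∀ q .{{_ : NonZero q}} c F → ∑ q (λ s → F ((c + s) % q)) ≤ ∑ q F
∑-shift-≤ q c F = ∑-injection-≤ q (λ s → (c + s) % q) F (λ s _ → m%n<n (c + s) q)
                    (λ s t → %-shift-injective q c s t)

-- The inequality `∑-shift-≤`, applied to the inverse shift by `c′`.
∑-shift-≥ : ∀ q .{{_ : NonZero q}} c F → ∑ q F ≤ ∑ q (λ s → F ((c + s) % q))
∑-shift-≥ q c F = begin
  ∑ q F                                     ≡⟨ ∑-cong q (λ s s<q → cong F (undo s s<q)) ⟨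
  ∑ q (λ s → F ((c + (c′ + s) % q) % q))    ≤⟨ ∑-shift-≤ q c′ (λ s → F ((c + s) % q)) ⟩
  ∑ q (λ s → F ((c + s) % q))               ∎
  where
  open ≤-Reasoning
  c′ = q ∸ c % q
  undo : ∀ s → s < q → (c + (c′ + s) % q) % q ≡ s
  undo s s<q = begin-equality
    (c + (c′ + s) % q) % q                    ≡⟨ %-distribˡ-+ c _ q ⟩
    (c % q + (c′ + s) % q % q) % q            ≡⟨ cong (λ x → (c % q + x) % q) (m%n%n≡m%n (c′ + s) q) ⟩
    (c % q + (c′ + s) % q) % q                ≡⟨ cong (λ x → (x + (c′ + s) % q) % q) (m%n%n≡m%n c q) ⟨
    (c % q % q + (c′ + s) % q) % q            ≡⟨ %-distribˡ-+ (c % q) (c′ + s) q ⟨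
    (c % q + (c′ + s)) % q                    ≡⟨ cong (_% q) (+-assoc (c % q) c′ s) ⟨
    (c % q + c′ + s) % q                      ≡⟨ cong (λ x → (x + s) % q) (m+[n∸m]≡n (m%n≤n c q)) ⟩
    (q + s) % q                               ≡⟨ cong (_% q) (+-comm q s) ⟩
    (s + q) % q                               ≡⟨ [m+n]%n≡m%n s q ⟩
    s % q                                     ≡⟨ m<n⇒m%n≡m s<q ⟩
    s                                         ∎

affine : (q : ℕ) .{{_ : NonZero q}} → ℕ → ℕ → ℕ → ℕ
affine q l s a = (l * a + s) % q

∑-affine-≥ : ∀ q .{{_ : NonZero q}} l a F → ∑ q F ≤ ∑ q (λ s → F (affine q l s a))
∑-affine-≥ q l a F = ∑-shift-≥ q (l * a) F

-- For distinct a and b the pair (g a , g b) is uniformly distributed as g runs over all affine maps.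
∑∑-affine-≤ : ∀ q .{{_ : NonZero q}} → Prime q → ∀ a b → b < a → a < q → ∀ F →
              ∑ q (λ l → ∑ q (λ s → F (affine q l s a) * F (affine q l s b))) ≤ ∑ q F * ∑ q F
∑∑-affine-≤ q pq a b b<a a<q F = begin
  ∑ q (λ l → ∑ q (λ s → F (affine q l s a) * F (affine q l s b)))
    ≡⟨ ∑-cong q (λ l _ → ∑-cong q (λ s _ → cong (λ x → F x * F (affine q l s b)) (relative l s))) ⟩
  ∑ q (λ l → ∑ q (λ s → F ((affine q l s b + l * h) % q) * F (affine q l s b)))
    ≤⟨ ∑-mono q (λ l _ → ∑-shift-≤ q (l * b) (λ u → F ((u + l * h) % q) * F u)) ⟩
  ∑ q (λ l → ∑ q (λ u → F ((u + l * h) % q) * F u))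
    ≡⟨ ∑-swap q q _ ⟩
  ∑ q (λ u → ∑ q (λ l → F ((u + l * h) % q) * F u))
    ≡⟨ ∑-cong q (λ u _ → ∑-*ʳ q (F u) _) ⟩
  ∑ q (λ u → ∑ q (λ l → F ((u + l * h) % q)) * F u)
    ≤⟨ ∑-mono q (λ u _ → *-monoˡ-≤ (F u) (∑-injection-≤ q (λ l → (u + l * h) % q) F
         (λ l _ → m%n<n (u + l * h) q) (%-affine-injective q pq u h 1≤h h<q))) ⟩
  ∑ q (λ u → ∑ q F * F u)
    ≡⟨ ∑-*ˡ q (∑ q F) F ⟩
  ∑ q F * ∑ q F ∎
  where
  open ≤-Reasoning
  h = a ∸ b
  1≤h : 1 ≤ h
  1≤h = m<n⇒0<n∸m b<a
  h<q : h < q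
  h<q = ≤-<-trans (m∸n≤m a b) a<q
  -- The new coordinates are u, the image of b, and l h, the difference of the two images: for fixed
  -- l, u is a shift of s, and for fixed u, the image u + l h of a is injective in l because q is
  -- prime.
  relative : ∀ l s → affine q l s a ≡ (affine q l s b + l * h) % q
  relative l s = begin-equality
    (l * a + s) % q                         ≡⟨ cong (λ x → (l * x + s) % q) (m+[n∸m]≡n (<⇒≤ b<a)) ⟨
    (l * (b + h) + s) % q                   ≡⟨ cong (_% q) (r l b h s) ⟩
    (l * b + s + l * h) % q                 ≡⟨ %-distribˡ-+ (l * b + s) (l * h) q ⟩
    ((l * b + s) % q + (l * h) % q) % q     ≡⟨ cong (λ x → (x + (l * h) % q) % q) (m%n%n≡m%n (l * b + s) q) ⟨
    ((l * b + s) % q % q + (l * h) % q) % q ≡⟨ %-distribˡ-+ ((l * b + s) % q) (l * h) q ⟨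
    ((l * b + s) % q + l * h) % q           ∎
    where
    r : ∀ l b h s → l * (b + h) + s ≡ l * b + s + l * h
    r = solve-∀

affine-additive : ∀ q .{{_ : NonZero q}} l s {a b c d} → a + b ≡ c + d →
                  (affine q l s a + affine q l s b) % q ≡ (affine q l s c + affine q l s d) % q
affine-additive q l s {a} {b} {c} {d} e = begin
  (affine q l s a + affine q l s b) % q    ≡⟨ %-distribˡ-+ (l * a + s) (l * b + s) q ⟨
  ((l * a + s) + (l * b + s)) % q          ≡⟨ cong (_% q) (r l s a b) ⟩
  (l * (a + b) + (s + s)) % q              ≡⟨ cong (λ x → (l * x + (s + s)) % q) e ⟩
  (l * (c + d) + (s + s)) % q              ≡⟨ cong (_% q) (r l s c d) ⟨
  ((l * c + s) + (l * d + s)) % q          ≡⟨ %-distribˡ-+ (l * c + s) (l * d + s) q ⟩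
  (affine q l s c + affine q l s d) % q    ∎
  where
  open ≡-Reasoning
  r : ∀ l s a b → (l * a + s) + (l * b + s) ≡ l * (a + b) + (s + s)
  r = solve-∀

-- Hits, coincidences and equal distances

pairs : ℕ → (ℕ → ℕ) → ℕ
pairs n y = ∑ n (λ a → ∑ a (λ b → y a * y b))

-- For a count c this is c ≤ [c ≥ 1] + c(c - 1)/2, because an element that is added forms a pair
-- with every earlier one. It bounds the number of nonempty cells from below by a first and a second
-- moment.
∑≤𝟙+pairs : ∀ n y → (∀ a → y a ≤ 1) → ∑ n y ≤ 𝟙 (1 ≤? ∑ n y) + pairs n y
∑≤𝟙+pairs zero    y y≤1 = z≤n
∑≤𝟙+pairs (suc n) y y≤1 with y n in eq | y≤1 n
... | 0 | _ = begin
  ∑ n y + 0                                                ≡⟨ +-identityʳ _ ⟩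
  ∑ n y                                                    ≤⟨ ∑≤𝟙+pairs n y y≤1 ⟩
  𝟙 (1 ≤? ∑ n y) + pairs n y                               ≡⟨ cong₂ (λ u v → 𝟙 (1 ≤? u) + v) (+-identityʳ (∑ n y)) (+-identityʳ (pairs n y)) ⟨
  𝟙 (1 ≤? ∑ n y + 0) + (pairs n y + 0)                     ≡⟨ cong (λ u → 𝟙 (1 ≤? ∑ n y + 0) + (pairs n y + u)) (∑-zero n (λ _ _ → refl)) ⟨
  𝟙 (1 ≤? ∑ n y + 0) + (pairs n y + ∑ n (λ _ → 0))         ∎
  where open ≤-Reasoning
... | 1 | _ = begin
  ∑ n y + 1                                                ≡⟨ +-comm (∑ n y) 1 ⟩
  1 + ∑ n y                                                ≤⟨ s≤s (m≤n+m (∑ n y) (pairs n y)) ⟩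
  1 + (pairs n y + ∑ n y)                                  ≡⟨ cong₂ (λ u v → u + (pairs n y + v)) (𝟙-yes (1 ≤? ∑ n y + 1) (m≤n+m 1 (∑ n y)))
                                                               (∑-cong n (λ i _ → *-identityˡ (y i))) ⟨
  𝟙 (1 ≤? ∑ n y + 1) + (pairs n y + ∑ n (λ b → 1 * y b))   ∎
  where open ≤-Reasoning
... | suc (suc _) | s≤s ()

∑∑-swap : ∀ q k (f : ℕ → ℕ → ℕ → ℕ) →
          ∑ q (λ l → ∑ q (λ s → ∑ k (λ i → f l s i))) ≡ ∑ k (λ i → ∑ q (λ l → ∑ q (λ s → f l s i)))
∑∑-swap q k f = trans (∑-cong q (λ l _ → ∑-swap q k (f l))) (∑-swap q k (λ l i → ∑ q (λ s → f l s i)))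

∑∑-*ˡ : ∀ q k (f : ℕ → ℕ → ℕ) → ∑ q (λ l → ∑ q (λ s → k * f l s)) ≡ k * ∑ q (λ l → ∑ q (f l))
∑∑-*ˡ q k f = trans (∑-cong q (λ l _ → ∑-*ˡ q k (f l))) (∑-*ˡ q k (λ l → ∑ q (f l)))

pairs≤ : ∀ n x → pairs n x ≤ ∑ n x * ∑ n x
pairs≤ n x = begin
  ∑ n (λ a → ∑ a (λ b → x a * x b))   ≤⟨ ∑-mono n (λ a a<n → extend a (<⇒≤ a<n)) ⟩
  ∑ n (λ a → ∑ n (λ b → x a * x b))   ≡⟨ ∑-cong n (λ a _ → ∑-*ˡ n (x a) x) ⟩
  ∑ n (λ a → x a * ∑ n x)             ≡⟨ ∑-*ʳ n (∑ n x) x ⟩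
  ∑ n x * ∑ n x                       ∎
  where
  open ≤-Reasoning
  extend : ∀ a → a ≤ n → ∑ a (λ b → x a * x b) ≤ ∑ n (λ b → x a * x b)
  extend a a≤n = begin
    ∑ a f                                  ≤⟨ m≤m+n _ _ ⟩
    ∑ a f + ∑ (n ∸ a) (λ i → f (a + i))    ≡⟨ ∑-split a (n ∸ a) f ⟨
    ∑ (a + (n ∸ a)) f                      ≡⟨ cong (λ k → ∑ k f) (m+[n∸m]≡n a≤n) ⟩
    ∑ n f                                  ∎
    where
    f : ℕ → ℕ
    f b = x a * x b

-- Affine maps modulo q respect equality of two-term sums but not of absolute differences; here the
-- unknown signs are resolved into two possible equations between sums.
∣-∣-cases : ∀ a b c d → ∣ a - b ∣ ≡ ∣ c - d ∣ → a + d ≡ c + b ⊎ a + c ≡ d + b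
∣-∣-cases a b c d e with ≤-total a b | ≤-total c d
... | inj₁ a≤b | inj₁ c≤d = inj₁ (begin
  a + d              ≡⟨ cong (a +_) (m+[n∸m]≡n c≤d) ⟨
  a + (c + (d ∸ c))  ≡⟨ cong (λ z → a + (c + z)) e′ ⟨
  a + (c + (b ∸ a))  ≡⟨ r a c (b ∸ a) ⟩
  c + (a + (b ∸ a))  ≡⟨ cong (c +_) (m+[n∸m]≡n a≤b) ⟩
  c + b              ∎)
  where
  open ≡-Reasoning
  e′ = trans (sym (m≤n⇒∣m-n∣≡n∸m a≤b)) (trans e (m≤n⇒∣m-n∣≡n∸m c≤d))
  r : ∀ a c u → a + (c + u) ≡ c + (a + u)
  r = solve-∀
... | inj₁ a≤b | inj₂ d≤c = inj₂ (begin
  a + c              ≡⟨ cong (a +_) (m+[n∸m]≡n d≤c) ⟨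
  a + (d + (c ∸ d))  ≡⟨ cong (λ z → a + (d + z)) e′ ⟨
  a + (d + (b ∸ a))  ≡⟨ r a d (b ∸ a) ⟩
  d + (a + (b ∸ a))  ≡⟨ cong (d +_) (m+[n∸m]≡n a≤b) ⟩
  d + b              ∎)
  where
  open ≡-Reasoning
  e′ = trans (sym (m≤n⇒∣m-n∣≡n∸m a≤b)) (trans e (m≤n⇒∣n-m∣≡n∸m d≤c))
  r : ∀ a c u → a + (c + u) ≡ c + (a + u)
  r = solve-∀
... | inj₂ b≤a | inj₁ c≤d = inj₂ (begin
  a + c              ≡⟨ cong (_+ c) (m+[n∸m]≡n b≤a) ⟨
  b + (a ∸ b) + c    ≡⟨ cong (λ z → b + z + c) e′ ⟩
  b + (d ∸ c) + c    ≡⟨ r b c (d ∸ c) ⟩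
  c + (d ∸ c) + b    ≡⟨ cong (_+ b) (m+[n∸m]≡n c≤d) ⟩
  d + b              ∎)
  where
  open ≡-Reasoning
  e′ = trans (sym (m≤n⇒∣n-m∣≡n∸m b≤a)) (trans e (m≤n⇒∣m-n∣≡n∸m c≤d))
  r : ∀ b c u → b + u + c ≡ c + u + b
  r = solve-∀
... | inj₂ b≤a | inj₂ d≤c = inj₁ (begin
  a + d              ≡⟨ cong (_+ d) (m+[n∸m]≡n b≤a) ⟨
  b + (a ∸ b) + d    ≡⟨ cong (λ z → b + z + d) e′ ⟩
  b + (c ∸ d) + d    ≡⟨ r b d (c ∸ d) ⟩
  d + (c ∸ d) + b    ≡⟨ cong (_+ b) (m+[n∸m]≡n d≤c) ⟩
  c + b              ∎)
  where
  open ≡-Reasoning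
  e′ = trans (sym (m≤n⇒∣n-m∣≡n∸m b≤a)) (trans e (m≤n⇒∣n-m∣≡n∸m d≤c))
  r : ∀ b c u → b + u + c ≡ c + u + b
  r = solve-∀

-- Cells and a good affine map

module Selection
  (n : ℕ) (x : ℕ → ℕ) (x≤1 : ∀ a → x a ≤ 1)
  (p : ℕ) .{{_ : NonZero p}} (p-prime : Prime p) (2<p : 2 < p)
  (q : ℕ) .{{_ : NonZero q}} (q-prime : Prime q) (n≤q : n ≤ q)
  (w : ℕ) (8p²w≤q : 8 * (p * p) * w ≤ q)
  where

  m : ℕ
  m = ∑ n x

  -- Cells of width w are spaced in multiples of 2w, so that two offsets add up to less than the
  -- spacing and a sum of two points determines the sum of their marks.
  lo : ℕ → ℕ
  lo i = (w + w) * mark p i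

  cell : ℕ → ℕ → ℕ
  cell i = window (lo i) w

  y : ℕ → ℕ → ℕ → ℕ → ℕ
  y l s i a = x a * cell i (affine q l s a)

  c : ℕ → ℕ → ℕ → ℕ
  c l s i = ∑ n (y l s i)

  -- This becomes the size of the Sidon set, as one element is taken from each nonempty cell.
  H : ℕ → ℕ → ℕ
  H l s = ∑ p (λ i → 𝟙 (1 ≤? c l s i))

  -- The cells lie in [0 , q/2), so that sums of two elements do not wrap around modulo q.
  cell-end : ∀ i → i < p → (lo i + w) + (lo i + w) ≤ q
  cell-end i i<p = begin
    (lo i + w) + (lo i + w)                            ≤⟨ +-mono-≤ half half ⟩
    (w + w) * ((p + p) * p) + (w + w) * ((p + p) * p)  ≡⟨ r p w ⟩
    8 * (p * p) * w                                    ≤⟨ 8p²w≤q ⟩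
    q                                                  ∎
    where
    open ≤-Reasoning
    r : ∀ p w → (w + w) * ((p + p) * p) + (w + w) * ((p + p) * p) ≡ 8 * (p * p) * w
    r = solve-∀
    half : lo i + w ≤ (w + w) * ((p + p) * p)
    half = begin
      lo i + w                     ≤⟨ +-monoʳ-≤ (lo i) (m≤m+n w w) ⟩
      lo i + (w + w)               ≡⟨ +-comm (lo i) (w + w) ⟩
      (w + w) + lo i               ≡⟨ *-suc (w + w) (mark p i) ⟨
      (w + w) * suc (mark p i)     ≤⟨ *-monoʳ-≤ (w + w) (mark< p i i<p) ⟩
      (w + w) * ((p + p) * p)      ∎

  ∑-cell : ∀ i → i < p → ∑ q (cell i) ≡ w
  ∑-cell i i<p = ∑-window (lo i) w (≤-trans (m≤m+n (lo i + w) (lo i + w)) (cell-end i i<p))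

  y≤1 : ∀ l s i a → y l s i a ≤ 1
  y≤1 l s i a = *-mono-≤ (x≤1 a) (𝟙≤1 ((lo i ≤? affine q l s a) ×-dec (affine q l s a <? lo i + w)))

  -- For each multiplier l, the image of an element runs through all residues as s varies, and so
  -- meets each of the p cells w times.
  firstMoment : q * (p * (m * w)) ≤ ∑ q (λ l → ∑ q (λ s → ∑ p (c l s)))
  firstMoment = begin
    q * (p * (m * w))                                       ≡⟨ ∑-const q _ ⟨
    ∑ q (λ l → p * (m * w))                                 ≤⟨ ∑-mono q (λ l _ → fixed l) ⟩
    ∑ q (λ l → ∑ q (λ s → ∑ p (c l s)))                     ∎
    where
    open ≤-Reasoning
    fixed : ∀ l → p * (m * w) ≤ ∑ q (λ s → ∑ p (c l s))
    fixed l = begin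
      p * (m * w)                                           ≡⟨ ∑-const p _ ⟨
      ∑ p (λ i → m * w)                                     ≡⟨ ∑-cong p (λ i _ → sym (∑-*ʳ n w x)) ⟩
      ∑ p (λ i → ∑ n (λ a → x a * w))
        ≤⟨ ∑-mono p (λ i i<p → ∑-mono n (λ a _ → *-monoʳ-≤ (x a)
             (≤-trans (≤-reflexive (sym (∑-cell i i<p))) (∑-affine-≥ q l a (cell i))))) ⟩
      ∑ p (λ i → ∑ n (λ a → x a * ∑ q (λ s → cell i (affine q l s a))))
        ≡⟨ ∑-cong p (λ i _ → ∑-cong n (λ a _ → ∑-*ˡ q (x a) _)) ⟨
      ∑ p (λ i → ∑ n (λ a → ∑ q (λ s → y l s i a)))
        ≡⟨ ∑-cong p (λ i _ → ∑-swap n q _) ⟩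
      ∑ p (λ i → ∑ q (λ s → c l s i))
        ≡⟨ ∑-swap p q _ ⟩
      ∑ q (λ s → ∑ p (c l s)) ∎

  -- There are at most m² pairs, and by two-point uniformity a given pair lands in a given cell for
  -- at most w² of the q² maps.
  secondMoment : ∑ q (λ l → ∑ q (λ s → ∑ p (λ i → pairs n (y l s i)))) ≤ p * (m * m * (w * w))
  secondMoment = begin
    ∑ q (λ l → ∑ q (λ s → ∑ p (λ i → pairs n (y l s i))))
      ≡⟨ ∑∑-swap q p _ ⟩
    ∑ p (λ i → ∑ q (λ l → ∑ q (λ s → pairs n (y l s i))))
      ≤⟨ ∑-mono p fixed ⟩
    ∑ p (λ i → m * m * (w * w))
      ≡⟨ ∑-const p _ ⟩
    p * (m * m * (w * w)) ∎
    where
    open ≤-Reasoning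
    r : ∀ a b c d → a * c * (b * d) ≡ a * b * (c * d)
    r = solve-∀
    pair : ∀ i → i < p → ∀ a → a < n → ∀ b → b < a →
           ∑ q (λ l → ∑ q (λ s → y l s i a * y l s i b)) ≤ x a * x b * (w * w)
    pair i i<p a a<n b b<a = begin
      ∑ q (λ l → ∑ q (λ s → y l s i a * y l s i b))
        ≡⟨ ∑-cong q (λ l _ → ∑-cong q (λ s _ → r (x a) (x b) (cell i (affine q l s a)) (cell i (affine q l s b)))) ⟩
      ∑ q (λ l → ∑ q (λ s → x a * x b * (cell i (affine q l s a) * cell i (affine q l s b))))
        ≡⟨ ∑∑-*ˡ q (x a * x b) _ ⟩
      x a * x b * ∑ q (λ l → ∑ q (λ s → cell i (affine q l s a) * cell i (affine q l s b)))
        ≤⟨ *-monoʳ-≤ (x a * x b) (∑∑-affine-≤ q q-prime a b b<a (<-≤-trans a<n n≤q) (cell i)) ⟩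
      x a * x b * (∑ q (cell i) * ∑ q (cell i))
        ≡⟨ cong (λ u → x a * x b * (u * u)) (∑-cell i i<p) ⟩
      x a * x b * (w * w) ∎
    fixed : ∀ i → i < p → ∑ q (λ l → ∑ q (λ s → pairs n (y l s i))) ≤ m * m * (w * w)
    fixed i i<p = begin
      ∑ q (λ l → ∑ q (λ s → pairs n (y l s i)))
        ≡⟨ ∑∑-swap q n _ ⟩
      ∑ n (λ a → ∑ q (λ l → ∑ q (λ s → ∑ a (λ b → y l s i a * y l s i b))))
        ≡⟨ ∑-cong n (λ a _ → ∑∑-swap q a _) ⟩
      ∑ n (λ a → ∑ a (λ b → ∑ q (λ l → ∑ q (λ s → y l s i a * y l s i b))))
        ≤⟨ ∑-mono n (λ a a<n → ∑-mono a (pair i i<p a a<n)) ⟩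
      ∑ n (λ a → ∑ a (λ b → x a * x b * (w * w)))
        ≡⟨ ∑-cong n (λ a _ → ∑-*ʳ a (w * w) _) ⟩
      ∑ n (λ a → ∑ a (λ b → x a * x b) * (w * w))
        ≡⟨ ∑-*ʳ n (w * w) _ ⟩
      pairs n x * (w * w)
        ≤⟨ *-monoˡ-≤ (w * w) (pairs≤ n x) ⟩
      m * m * (w * w) ∎

  average : q * (p * (m * w)) ≤ ∑ q (λ l → ∑ q (H l)) + p * (m * m * (w * w))
  average = begin
    q * (p * (m * w))
      ≤⟨ firstMoment ⟩
    ∑ q (λ l → ∑ q (λ s → ∑ p (c l s)))
      ≤⟨ ∑-mono q (λ l _ → ∑-mono q (λ s _ → ∑-mono p (λ i _ → ∑≤𝟙+pairs n (y l s i) (y≤1 l s i)))) ⟩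
    ∑ q (λ l → ∑ q (λ s → ∑ p (λ i → 𝟙 (1 ≤? c l s i) + pairs n (y l s i))))
      ≡⟨ ∑-cong q (λ l _ → ∑-cong q (λ s _ → ∑-+ p _ _)) ⟩
    ∑ q (λ l → ∑ q (λ s → H l s + ∑ p (λ i → pairs n (y l s i))))
      ≡⟨ ∑-cong q (λ l _ → ∑-+ q _ _) ⟩
    ∑ q (λ l → ∑ q (H l) + ∑ q (λ s → ∑ p (λ i → pairs n (y l s i))))
      ≡⟨ ∑-+ q _ _ ⟩
    ∑ q (λ l → ∑ q (H l)) + ∑ q (λ l → ∑ q (λ s → ∑ p (λ i → pairs n (y l s i))))
      ≤⟨ +-monoʳ-≤ _ secondMoment ⟩
    ∑ q (λ l → ∑ q (H l)) + p * (m * m * (w * w)) ∎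
    where open ≤-Reasoning

  -- The coincidences are already summed over all maps in `average`, so a map need only be chosen
  -- for its number of cells hit: a best l, then a best s.
  goodMap : ∃[ l ] ∃[ s ] (q * (p * (m * w)) ≤ q * (q * H l s) + p * (m * m * (w * w)))
  goodMap with ∑-max q (>-nonZero⁻¹ q) (λ l → ∑ q (H l))
  ... | l , _ , h with ∑-max q (>-nonZero⁻¹ q) (H l)
  ...   | s , _ , h′ = l , s , ≤-trans average (+-monoˡ-≤ _ (≤-trans h (*-monoʳ-≤ q h′)))

  module _ (l s : ℕ) where

    hits : List ℕ
    hits = filter (λ i → 1 ≤? c l s i) (downFrom p)

    pick : ℕ → ℕ
    pick i = find n (y l s i)

    hits-unique : Unique hits
    hits-unique = Unique.filter⁺ (λ i → 1 ≤? c l s i) (Unique.downFrom⁺ p)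

    length-hits : length hits ≡ H l s
    length-hits = length-filter-downFrom (λ i → 1 ≤? c l s i) p

    g : ℕ → ℕ
    g i = affine q l s (pick i)

    hit : ∀ {i} → i ∈ hits → i < p × pick i < n × 1 ≤ y l s i (pick i)
    hit {i} i∈ with ∈-filter⁻ (λ i → 1 ≤? c l s i) {xs = downFrom p} i∈
    ... | i∈p , 1≤c = ∈-downFrom⁻ i∈p , find-correct n (y l s i) 1≤c

    hit-x : ∀ {i} → i ∈ hits → 1 ≤ x (pick i)
    hit-x {i} i∈ with x (pick i) | proj₂ (proj₂ (hit i∈))
    ... | suc _ | _ = s≤s z≤n

    hit-cell : ∀ {i} → i ∈ hits → lo i ≤ g i × g i < lo i + w
    hit-cell {i} i∈ = 𝟙⁻¹ ((lo i ≤? g i) ×-dec (g i <? lo i + w))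
      (n≢0⇒n>0 λ e → <⇒≱ (proj₂ (proj₂ (hit i∈))) (≤-reflexive (trans (cong (x (pick i) *_) e) (*-zeroʳ (x (pick i))))))

    sum<q : ∀ {i j} → i ∈ hits → j ∈ hits → g i + g j < q
    sum<q {i} {j} i∈ j∈ with ≤-total (lo i) (lo j)
    ... | inj₁ le = <-≤-trans (+-mono-< (<-≤-trans (proj₂ (hit-cell i∈)) (+-monoˡ-≤ w le)) (proj₂ (hit-cell j∈)))
                              (cell-end j (proj₁ (hit j∈)))
    ... | inj₂ ge = <-≤-trans (+-mono-< (proj₂ (hit-cell i∈)) (<-≤-trans (proj₂ (hit-cell j∈)) (+-monoˡ-≤ w ge)))
                              (cell-end i (proj₁ (hit i∈)))

    -- The equation survives the affine map modulo q, becomes one between integers because neither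
    -- sum reaches q, and is then divided by 2w: the quotients are the sums of marks.
    marks : ∀ {i j k t} → i ∈ hits → j ∈ hits → k ∈ hits → t ∈ hits →
            pick i + pick j ≡ pick k + pick t → mark p i + mark p j ≡ mark p k + mark p t
    marks {i} {j} {k} {t} i∈ j∈ k∈ t∈ e =
      proj₁ (division-unique (w + w) (mark p i + mark p j) (mark p k + mark p t) (+-mono-< (error< i∈) (error< j∈)) (+-mono-< (error< k∈) (error< t∈)) (begin
        (w + w) * (mark p i + mark p j) + (error i + error j)   ≡⟨ r (w + w) (mark p i) (mark p j) (error i) (error j) ⟩
        (lo i + error i) + (lo j + error j)                     ≡⟨ cong₂ _+_ (lo+error i∈) (lo+error j∈) ⟩
        g i + g j                                               ≡⟨ m<n⇒m%n≡m (sum<q i∈ j∈) ⟨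
        (g i + g j) % q                                         ≡⟨ affine-additive q l s e ⟩
        (g k + g t) % q                                         ≡⟨ m<n⇒m%n≡m (sum<q k∈ t∈) ⟩
        g k + g t                                               ≡⟨ cong₂ _+_ (lo+error k∈) (lo+error t∈) ⟨
        (lo k + error k) + (lo t + error t)                     ≡⟨ r (w + w) (mark p k) (mark p t) (error k) (error t) ⟨
        (w + w) * (mark p k + mark p t) + (error k + error t)   ∎))
      where
      open ≡-Reasoning
      error : ℕ → ℕ
      error i = g i ∸ lo i
      lo+error : ∀ {i} → i ∈ hits → lo i + error i ≡ g i
      lo+error i∈ = m+[n∸m]≡n (proj₁ (hit-cell i∈))
      error< : ∀ {i} → i ∈ hits → error i < w
      error< {i} i∈ = +-cancelˡ-< (lo i) (error i) w (subst (_< lo i + w) (sym (lo+error i∈)) (proj₂ (hit-cell i∈)))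
      r : ∀ d a b e f → d * (a + b) + (e + f) ≡ (d * a + e) + (d * b + f)
      r = solve-∀

    -- For each of the two equations between sums, `mark-sidon` leaves two matchings of the indices.
    -- One of them identifies i with j and is excluded; the other is as claimed.
    sidon : ∀ {i j k t} → i ∈ hits → j ∈ hits → k ∈ hits → t ∈ hits → i ≢ j →
            ∣ pick i - pick j ∣ ≡ ∣ pick k - pick t ∣ → (i ≡ k × j ≡ t) ⊎ (i ≡ t × j ≡ k)
    sidon {i} {j} {k} {t} i∈ j∈ k∈ t∈ i≢j e =
      [ (λ sum≡ → [ (λ (i≡k , t≡j) → inj₁ (i≡k , sym t≡j)) , (λ (i≡j , _) → contradiction i≡j i≢j) ]′
                    (mark-sidon p p-prime 2<p (bound i∈) (bound j∈) (bound k∈) (bound t∈) (marks i∈ t∈ k∈ j∈ sum≡)))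
      , (λ sum≡ → [ (λ (i≡t , k≡j) → inj₂ (i≡t , sym k≡j)) , (λ (i≡j , _) → contradiction i≡j i≢j) ]′
                    (mark-sidon p p-prime 2<p (bound i∈) (bound j∈) (bound t∈) (bound k∈) (marks i∈ k∈ t∈ j∈ sum≡)))
      ]′ (∣-∣-cases (pick i) (pick j) (pick k) (pick t) e)
      where
      bound : ∀ {i} → i ∈ hits → i < p
      bound i∈ = proj₁ (hit i∈)

-- 8 q²h ≥ 8 q p m w − p m (8 m w) w ≥ 7 q p m w.
manyHits : ∀ {p q m w h} .{{_ : NonZero q}} .{{_ : NonZero p}} .{{_ : NonZero w}} →
           m ≤ p * p → 8 * (p * p) * w ≤ q → q ≤ 16 * (p * p) * w →
           q * (p * (m * w)) ≤ q * (q * h) + p * (m * m * (w * w)) → m ≤ 8 * (16 * (p * h))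
manyHits {p} {q} {m} {w} {h} m≤p² 8p²w≤q q≤16p²w avg =
  ≤-trans (m≤n*m m 7) (*-cancelˡ-≤ (p * w) 7m≤)
  where
  open ≤-Reasoning
  instance
    pw≢0 : NonZero (p * w)
    pw≢0 = m*n≢0 p w
  X = q * (p * (m * w))
  -- Here m ≤ p² enters: the coincidences amount to at most an eighth of the first moment.
  8mw≤q : 8 * m * w ≤ q
  8mw≤q = ≤-trans (*-monoˡ-≤ w (*-monoʳ-≤ 8 m≤p²)) 8p²w≤q
  r₁ : ∀ p m w → 8 * (p * (m * m * (w * w))) ≡ 8 * m * w * (p * (m * w))
  r₁ = solve-∀
  r₂ : ∀ x → 7 * x + x ≡ 8 * x
  r₂ = solve-∀
  r₃ : ∀ q p m w → q * (7 * (p * (m * w))) ≡ 7 * (q * (p * (m * w)))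
  r₃ = solve-∀
  r₄ : ∀ q h → 8 * (q * (q * h)) ≡ q * (8 * (q * h))
  r₄ = solve-∀
  r₅ : ∀ a b p w h → a * (b * (p * p) * w * h) ≡ p * w * (a * (b * (p * h)))
  r₅ = solve-∀
  r₇ : ∀ p w m → p * w * (7 * m) ≡ 7 * (p * (m * w))
  r₇ = solve-∀
  7X≤ : 7 * X ≤ 8 * (q * (q * h))
  7X≤ = +-cancelʳ-≤ X _ _ (begin
    7 * X + X                                             ≡⟨ r₂ X ⟩
    8 * X                                                 ≤⟨ *-monoʳ-≤ 8 avg ⟩
    8 * (q * (q * h) + p * (m * m * (w * w)))             ≡⟨ *-distribˡ-+ 8 (q * (q * h)) _ ⟩
    8 * (q * (q * h)) + 8 * (p * (m * m * (w * w)))       ≡⟨ cong (8 * (q * (q * h)) +_) (r₁ p m w) ⟩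
    8 * (q * (q * h)) + 8 * m * w * (p * (m * w))         ≤⟨ +-monoʳ-≤ (8 * (q * (q * h))) (*-monoˡ-≤ (p * (m * w)) 8mw≤q) ⟩
    8 * (q * (q * h)) + X                                 ∎)
  7pmw≤ : 7 * (p * (m * w)) ≤ 8 * (q * h)
  7pmw≤ = *-cancelˡ-≤ q (≤-trans (≤-reflexive (r₃ q p m w)) (≤-trans 7X≤ (≤-reflexive (r₄ q h))))
  7m≤ : p * w * (7 * m) ≤ p * w * (8 * (16 * (p * h)))
  7m≤ = begin
    p * w * (7 * m)                   ≡⟨ r₇ p w m ⟩
    7 * (p * (m * w))                 ≤⟨ 7pmw≤ ⟩
    8 * (q * h)                       ≤⟨ *-monoʳ-≤ 8 (*-monoˡ-≤ h q≤16p²w) ⟩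
    8 * (16 * (p * p) * w * h)        ≡⟨ r₅ 8 16 p w h ⟩
    p * w * (8 * (16 * (p * h)))      ∎

-- The elements are indexed by the cells that they come from. The pair k, l may be degenerate: for k
-- = l the condition says that `a` is injective on `is`.
Sidon : List ℕ → (ℕ → ℕ) → Set
Sidon is a = ∀ {i j k l} → i ∈ is → j ∈ is → k ∈ is → l ∈ is → i ≢ j →
             ∣ a i - a j ∣ ≡ ∣ a k - a l ∣ → (i ≡ k × j ≡ l) ⊎ (i ≡ l × j ≡ k)

SidonSelection : ℕ → ℕ → (ℕ → ℕ) → Set
SidonSelection M n x =
  ∃[ is ] ∃[ a ] (Unique is × (∀ {i} → i ∈ is → a i < n × 1 ≤ x (a i)) × Sidon is a
                  × ∑ n x ≤ M * (length is * length is))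

-- Squaring m ≤ 128 p h and inserting p² ≤ K m leaves a factor m to cancel. The bound on h stays in
-- squared form, which avoids square roots to the end.
square : ∀ {m p h K} .{{_ : NonZero m}} → m ≤ 8 * (16 * (p * h)) → p * p ≤ K * m →
         m ≤ 8 * (16 * (8 * (16 * K))) * (h * h)
square {m} {p} {h} {K} m≤ p²≤ = *-cancelˡ-≤ m (begin
  m * m                                           ≤⟨ *-mono-≤ m≤ m≤ ⟩
  8 * (16 * (p * h)) * (8 * (16 * (p * h)))       ≡⟨ r₁ 8 16 p h ⟩
  8 * (16 * (8 * (16 * (h * h * (p * p)))))
    ≤⟨ *-monoʳ-≤ 8 (*-monoʳ-≤ 16 (*-monoʳ-≤ 8 (*-monoʳ-≤ 16 (*-monoʳ-≤ (h * h) p²≤)))) ⟩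
  8 * (16 * (8 * (16 * (h * h * (K * m)))))       ≡⟨ r₂ 8 16 K m h ⟩
  m * (8 * (16 * (8 * (16 * K))) * (h * h))       ∎)
  where
  open ≤-Reasoning
  r₁ : ∀ a b p h → a * (b * (p * h)) * (a * (b * (p * h))) ≡ a * (b * (a * (b * (h * h * (p * p)))))
  r₁ = solve-∀
  r₂ : ∀ a b K m h → a * (b * (a * (b * (h * h * (K * m))))) ≡ m * (a * (b * (a * (b * K))) * (h * h))
  r₂ = solve-∀

-- Because d ≤ q, rounding q/d down costs at most a factor 2; this turns the 8 of the cell width
-- into the 16 of the upper bound on q.
width : ∀ d q .{{_ : NonZero d}} → d ≤ q → d * (q / d) ≤ q × q ≤ (d + d) * (q / d) × 1 ≤ q / d
width d q d≤q = lower , upper , 1≤w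
  where
  open ≤-Reasoning
  w = q / d
  lower : d * w ≤ q
  lower = ≤-trans (≤-reflexive (*-comm d w)) (m/n*n≤m q d)
  1≤w : 1 ≤ w
  1≤w = m≥n⇒m/n>0 d≤q
  upper : q ≤ (d + d) * w
  upper = begin
    q                    ≡⟨ m≡m%n+[m/n]*n q d ⟩
    q % d + w * d        ≤⟨ +-monoˡ-≤ (w * d) (m%n≤n q d) ⟩
    d + w * d            ≤⟨ +-monoˡ-≤ (w * d) (m≤m*n d w {{>-nonZero 1≤w}}) ⟩
    d * w + w * d        ≡⟨ r d w ⟩
    (d + d) * w          ∎
    where
    r : ∀ d w → d * w + w * d ≡ (d + d) * w
    r = solve-∀

komlósSulyokSzemerédi : ∃[ M ] (∀ n x → (∀ a → x a ≤ 1) → 1 ≤ ∑ n x → SidonSelection M n x)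
komlósSulyokSzemerédi = 8 * (16 * (8 * (16 * proj₁ primeNear√))) ,
  λ n x x≤1 1≤m → construct (proj₁ primeNear√) n x x≤1 1≤m (proj₂ primeNear√ (∑ n x) 1≤m)
  where
  construct : ∀ K n x → (∀ a → x a ≤ 1) → 1 ≤ ∑ n x →
              ∃[ p ] (Prime p × 2 < p × ∑ n x ≤ p * p × p * p ≤ K * ∑ n x) →
              SidonSelection (8 * (16 * (8 * (16 * K)))) n x
  -- The summand n keeps the elements of the set distinct modulo q, and 8p² makes the cell width
  -- positive.
  construct K n x x≤1 1≤m (p , pp , 2<p , m≤p² , p²≤Km) = finish (largePrime (n + 8 * (p * p)))
    where
    instance
      p≢0 : NonZero p
      p≢0 = prime⇒nonZero pp
      m≢0 : NonZero (∑ n x)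
      m≢0 = >-nonZero 1≤m
      d≢0 : NonZero (8 * (p * p))
      d≢0 = m*n≢0 8 (p * p) {{_}} {{m*n≢0 p p}}
    finish : ∃[ q ] (Prime q × n + 8 * (p * p) ≤ q) → SidonSelection (8 * (16 * (8 * (16 * K)))) n x
    finish (q , pq , N≤q) = hits l s , pick l s , hits-unique l s ,
        (λ i∈ → proj₁ (proj₂ (hit l s i∈)) , hit-x l s i∈) , sidon l s ,
        subst (λ h → ∑ n x ≤ 8 * (16 * (8 * (16 * K))) * (h * h)) (sym (length-hits l s))
          (square {p = p} {K = K} (manyHits {p} {q} {∑ n x} {w} {H l s} m≤p² 8p²w≤q q≤16p²w many) p²≤Km)
      where
      instance
        q≢0 : NonZero q
        q≢0 = prime⇒nonZero pq
      w = q / (8 * (p * p))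
      widths = width (8 * (p * p)) q (m+n≤o⇒n≤o n N≤q)
      8p²w≤q : 8 * (p * p) * w ≤ q
      8p²w≤q = proj₁ widths
      q≤16p²w : q ≤ 16 * (p * p) * w
      q≤16p²w = ≤-trans (proj₁ (proj₂ widths)) (≤-reflexive (cong (_* w) (sym (*-distribʳ-+ (p * p) 8 8))))
      instance
        w≢0 : NonZero w
        w≢0 = >-nonZero (proj₂ (proj₂ widths))
      open Selection n x x≤1 p pp 2<p q pq (m+n≤o⇒m≤o n N≤q) w 8p²w≤q
      l = proj₁ goodMap
      s = proj₁ (proj₂ goodMap)
      many = proj₂ (proj₂ goodMap)

-- Paths in the cube

flipPrefix : ∀ {n} → F₂^ n → ℕ → F₂^ n
flipPrefix x       zero    = x
flipPrefix []      (suc a) = []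
flipPrefix (b ∷ x) (suc a) = not b ∷ flipPrefix x a

dH-refl : ∀ {n} (x : F₂^ n) → dH x x ≡ 0
dH-refl []          = refl
dH-refl (true ∷ x)  = dH-refl x
dH-refl (false ∷ x) = dH-refl x

-- The two points differ exactly in the coordinates between positions a and b. The path stops moving
-- after n flips, hence the bounds on a and b.
dH-flipPrefix : ∀ {n} (x : F₂^ n) a b → a ≤ n → b ≤ n → dH (flipPrefix x a) (flipPrefix x b) ≡ ∣ a - b ∣
dH-flipPrefix x           zero    zero    _ _ = dH-refl x
dH-flipPrefix (true ∷ x)  zero    (suc b) _ (s≤s b≤n) = cong suc (dH-flipPrefix x zero b z≤n b≤n)
dH-flipPrefix (false ∷ x) zero    (suc b) _ (s≤s b≤n) = cong suc (dH-flipPrefix x zero b z≤n b≤n)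
dH-flipPrefix (true ∷ x)  (suc a) zero    (s≤s a≤n) _ =
  cong suc (trans (dH-flipPrefix x a zero a≤n z≤n) (∣-∣-identityʳ a))
dH-flipPrefix (false ∷ x) (suc a) zero    (s≤s a≤n) _ =
  cong suc (trans (dH-flipPrefix x a zero a≤n z≤n) (∣-∣-identityʳ a))
dH-flipPrefix (true ∷ x)  (suc a) (suc b) (s≤s a≤n) (s≤s b≤n) = dH-flipPrefix x a b a≤n b≤n
dH-flipPrefix (false ∷ x) (suc a) (suc b) (s≤s a≤n) (s≤s b≤n) = dH-flipPrefix x a b a≤n b≤n

∑F₂^ : ∀ n → (F₂^ n → ℕ) → ℕ
∑F₂^ zero    f = f []
∑F₂^ (suc n) f = ∑F₂^ n (λ x → f (false ∷ x)) + ∑F₂^ n (λ x → f (true ∷ x))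

∑F₂^-mono : ∀ n {f g : F₂^ n → ℕ} → (∀ x → f x ≤ g x) → ∑F₂^ n f ≤ ∑F₂^ n g
∑F₂^-mono zero    h = h []
∑F₂^-mono (suc n) h = +-mono-≤ (∑F₂^-mono n (λ x → h (false ∷ x))) (∑F₂^-mono n (λ x → h (true ∷ x)))

∑F₂^-+ : ∀ n (f g : F₂^ n → ℕ) → ∑F₂^ n (λ x → f x + g x) ≡ ∑F₂^ n f + ∑F₂^ n g
∑F₂^-+ zero    f g = refl
∑F₂^-+ (suc n) f g = trans (cong₂ _+_ (∑F₂^-+ n _ _) (∑F₂^-+ n _ _)) (+-interchange (∑F₂^ n _) _ _ _)

∑F₂^-zero : ∀ n → ∑F₂^ n (λ _ → 0) ≡ 0
∑F₂^-zero zero    = refl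
∑F₂^-zero (suc n) = cong₂ _+_ (∑F₂^-zero n) (∑F₂^-zero n)

∑F₂^-∑ : ∀ n k (f : F₂^ n → ℕ → ℕ) → ∑F₂^ n (λ x → ∑ k (f x)) ≡ ∑ k (λ a → ∑F₂^ n (λ x → f x a))
∑F₂^-∑ n zero    f = ∑F₂^-zero n
∑F₂^-∑ n (suc k) f = trans (∑F₂^-+ n _ _) (cong (_+ ∑F₂^ n (λ x → f x k)) (∑F₂^-∑ n k f))

-- Flipping a prefix translates the cube by a fixed vector; at each flipped coordinate the two
-- half-cubes trade places.
∑F₂^-flipPrefix : ∀ n a (f : F₂^ n → ℕ) → ∑F₂^ n (λ x → f (flipPrefix x a)) ≡ ∑F₂^ n f
∑F₂^-flipPrefix n       zero    f = refl
∑F₂^-flipPrefix zero    (suc a) f = refl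
∑F₂^-flipPrefix (suc n) (suc a) f =
  trans (cong₂ _+_ (∑F₂^-flipPrefix n a (λ x → f (true ∷ x))) (∑F₂^-flipPrefix n a (λ x → f (false ∷ x))))
        (+-comm (∑F₂^ n (λ x → f (true ∷ x))) _)

∑F₂^-max : ∀ n (f : F₂^ n → ℕ) → ∃[ x ] (∑F₂^ n f ≤ 2 ^ n * f x)
∑F₂^-max zero    f = [] , ≤-reflexive (sym (*-identityˡ (f [])))
∑F₂^-max (suc n) f with ∑F₂^-max n (λ x → f (false ∷ x)) | ∑F₂^-max n (λ x → f (true ∷ x))
... | x , hx | y , hy with ≤-total (f (false ∷ x)) (f (true ∷ y))
... | inj₁ le = true ∷ y , ≤-trans (+-mono-≤ (≤-trans hx (*-monoʳ-≤ (2 ^ n) le)) hy)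
                                   (≤-reflexive (double (2 ^ n) (f (true ∷ y))))
  where
  double : ∀ a b → a * b + a * b ≡ 2 * a * b
  double = solve-∀
... | inj₂ ge = false ∷ x , ≤-trans (+-mono-≤ hx (≤-trans hy (*-monoʳ-≤ (2 ^ n) ge)))
                                    (≤-reflexive (double (2 ^ n) (f (false ∷ x))))
  where
  double : ∀ a b → a * b + a * b ≡ 2 * a * b
  double = solve-∀

_≟ᵛ_ : ∀ {n} → DecidableEquality (F₂^ n)
_≟ᵛ_ = ≡-dec Bool._≟_

∑F₂^-δ : ∀ n (y : F₂^ n) → 1 ≤ ∑F₂^ n (λ x → 𝟙 (x ≟ᵛ y))
∑F₂^-δ zero    []          = ≤-refl
∑F₂^-δ (suc n) (false ∷ y) = ≤-trans (∑F₂^-δ n y) (≤-trans (∑F₂^-mono n λ x → step x (x ≟ᵛ y)) (m≤m+n _ _))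
  where
  step : ∀ x → Dec (x ≡ y) → 𝟙 (x ≟ᵛ y) ≤ 𝟙 ((false ∷ x) ≟ᵛ (false ∷ y))
  step x (yes e) = ≤-trans (𝟙≤1 (x ≟ᵛ y)) (≤-reflexive (sym (𝟙-yes ((false ∷ x) ≟ᵛ (false ∷ y)) (cong (false ∷_) e))))
  step x (no ne) = ≤-trans (≤-reflexive (𝟙-no (x ≟ᵛ y) ne)) z≤n
∑F₂^-δ (suc n) (true ∷ y)  = ≤-trans (∑F₂^-δ n y) (≤-trans (∑F₂^-mono n λ x → step x (x ≟ᵛ y)) (m≤n+m _ _))
  where
  step : ∀ x → Dec (x ≡ y) → 𝟙 (x ≟ᵛ y) ≤ 𝟙 ((true ∷ x) ≟ᵛ (true ∷ y))
  step x (yes e) = ≤-trans (𝟙≤1 (x ≟ᵛ y)) (≤-reflexive (sym (𝟙-yes ((true ∷ x) ≟ᵛ (true ∷ y)) (cong (true ∷_) e))))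
  step x (no ne) = ≤-trans (≤-reflexive (𝟙-no (x ≟ᵛ y) ne)) z≤n

module _ {n : ℕ} where
  open DecMembership (_≟ᵛ_ {n}) using (_∈?_) public

length≤∑F₂^ : ∀ {n} {S : List (F₂^ n)} → Unique S → length S ≤ ∑F₂^ n (λ x → 𝟙 (x ∈? S))
length≤∑F₂^ {S = []} [] = z≤n
length≤∑F₂^ {n} {S = y ∷ S} (y∉S ∷ uniq) = begin
  1 + length S                                                   ≤⟨ +-mono-≤ (∑F₂^-δ n y) (length≤∑F₂^ uniq) ⟩
  ∑F₂^ n (λ x → 𝟙 (x ≟ᵛ y)) + ∑F₂^ n (λ x → 𝟙 (x ∈? S))          ≡⟨ ∑F₂^-+ n _ _ ⟨
  ∑F₂^ n (λ x → 𝟙 (x ≟ᵛ y) + 𝟙 (x ∈? S))                         ≤⟨ ∑F₂^-mono n (λ x → step x (x ≟ᵛ y) (x ∈? S)) ⟩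
  ∑F₂^ n (λ x → 𝟙 (x ∈? (y ∷ S)))                                ∎
  where
  open ≤-Reasoning
  step : ∀ x → Dec (x ≡ y) → Dec (x ∈ S) → 𝟙 (x ≟ᵛ y) + 𝟙 (x ∈? S) ≤ 𝟙 (x ∈? (y ∷ S))
  step x (yes e) _ = ≤-trans
    (+-mono-≤ (𝟙≤1 (x ≟ᵛ y)) (≤-reflexive (𝟙-no (x ∈? S) λ x∈S → All.lookup y∉S x∈S (sym e))))
    (≤-reflexive (sym (𝟙-yes (x ∈? (y ∷ S)) (here e))))
  step x (no ne) (yes x∈S) = ≤-trans
    (+-mono-≤ (≤-reflexive (𝟙-no (x ≟ᵛ y) ne)) (𝟙≤1 (x ∈? S)))
    (≤-reflexive (sym (𝟙-yes (x ∈? (y ∷ S)) (there x∈S))))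
  step x (no ne) (no x∉S) = ≤-trans
    (≤-reflexive (cong₂ _+_ (𝟙-no (x ≟ᵛ y) ne) (𝟙-no (x ∈? S) x∉S))) z≤n

-- At every position a < n, at least |S| starting points have their path in S, because x ↦
-- `flipPrefix x a` permutes the cube. The best starting point is at least average.
densePath : ∀ n {S : List (F₂^ n)} → Unique S →
            ∃[ x ] (n * length S ≤ 2 ^ n * ∑ n (λ a → 𝟙 (flipPrefix x a ∈? S)))
densePath n {S} uniq with ∑F₂^-max n (λ x → ∑ n (λ a → 𝟙 (flipPrefix x a ∈? S)))
... | x , h = x , (begin
  n * length S                                                  ≡⟨ ∑-const n (length S) ⟨
  ∑ n (λ _ → length S)                                          ≤⟨ ∑-mono n (λ a _ → ≤-trans (length≤∑F₂^ uniq)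
                                                                     (≤-reflexive (sym (∑F₂^-flipPrefix n a _)))) ⟩
  ∑ n (λ a → ∑F₂^ n (λ x → 𝟙 (flipPrefix x a ∈? S)))            ≡⟨ ∑F₂^-∑ n n _ ⟨
  ∑F₂^ n (λ x → ∑ n (λ a → 𝟙 (flipPrefix x a ∈? S)))            ≤⟨ h ⟩
  2 ^ n * ∑ n (λ a → 𝟙 (flipPrefix x a ∈? S))                   ∎)
  where open ≤-Reasoning

-- From Sidon sets to rainbow sets

module _ {n : ℕ} (point : ℕ → F₂^ n) where

  DistancesDetermine : List ℕ → Set
  DistancesDetermine is =
    ∀ {i j k l} → i ∈ is → j ∈ is → k ∈ is → l ∈ is → i ≢ j →
    dH (point i) (point j) ≡ dH (point k) (point l) → (i ≡ k × j ≡ l) ⊎ (i ≡ l × j ≡ k)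

  ∈-pairDists⁻ : ∀ {is d} → Unique is → d ∈ pairDists (map point is) →
                 ∃[ i ] ∃[ j ] (i ∈ is × j ∈ is × i ≢ j × d ≡ dH (point i) (point j))
  ∈-pairDists⁻ {i ∷ is} (i∉is ∷ uniq) d∈ with ∈-++⁻ (map (dH (point i)) (map point is)) d∈
  ... | inj₁ d∈₁ with ∈-map⁻ (dH (point i)) d∈₁
  ...   | v , v∈ , refl with ∈-map⁻ point v∈
  ...     | j , j∈ , refl = i , j , here refl , there j∈ , All.lookup i∉is j∈ , refl
  ∈-pairDists⁻ {i ∷ is} (i∉is ∷ uniq) d∈ | inj₂ d∈₂ with ∈-pairDists⁻ uniq d∈₂
  ...   | j , k , j∈ , k∈ , j≢k , e = j , k , there j∈ , there k∈ , j≢k , e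

  map-unique : ∀ {B : Set} (f : ℕ → B) is → (∀ {i j} → i ∈ is → j ∈ is → f i ≡ f j → i ≡ j) →
               Unique is → Unique (map f is)
  map-unique f []       inj []            = []
  map-unique f (i ∷ is) inj (i∉is ∷ uniq) =
    All.map⁺ (All.tabulate λ j∈ e → All.lookup i∉is j∈ (inj (here refl) (there j∈) e)) ∷
    map-unique f is (λ i∈ j∈ → inj (there i∈) (there j∈)) uniq

  rainbow : ∀ {is} → Unique is → DistancesDetermine is → Rainbow (map point is)
  rainbow {is} uniq det = map-unique point is injective uniq , distances is uniq det
    where
    injective : ∀ {i j} → i ∈ is → j ∈ is → point i ≡ point j → i ≡ j
    injective {i} {j} i∈ j∈ e with i ≟ j
    ... | yes i≡j = i≡j
    -- If two points coincided, their distance would be that of the degenerate pair (i, i); either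
    -- alternative then identifies j with i.
    ... | no i≢j  = [ (λ (_ , j≡i) → sym j≡i) , (λ (_ , j≡i) → sym j≡i) ]′
                      (det i∈ j∈ i∈ i∈ i≢j (cong (dH (point i)) (sym e)))
    distances : ∀ is → Unique is → DistancesDetermine is → Unique (pairDists (map point is))
    distances []       []            det = []
    distances (i ∷ is) (i∉is ∷ uniq) det = Unique.++⁺
      (subst Unique (map-∘ is) (map-unique (λ j → dH (point i) (point j)) is first uniq))
      (distances is uniq (λ i∈ j∈ k∈ l∈ → det (there i∈) (there j∈) (there k∈) (there l∈)))
      (λ (d∈₁ , d∈₂) → disjoint d∈₁ (∈-pairDists⁻ uniq d∈₂))
      where
      i≢ : ∀ {j} → j ∈ is → i ≢ j
      i≢ = All.lookup i∉is
      first : ∀ {j k} → j ∈ is → k ∈ is → dH (point i) (point j) ≡ dH (point i) (point k) → j ≡ k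
      first j∈ k∈ e with det (here refl) (there j∈) (here refl) (there k∈) (i≢ j∈) e
      ... | inj₁ (_ , j≡k) = j≡k
      ... | inj₂ (i≡k , _) = contradiction i≡k (i≢ k∈)
      disjoint : ∀ {d} → d ∈ map (dH (point i)) (map point is) →
                 ∃[ k ] ∃[ l ] (k ∈ is × l ∈ is × k ≢ l × d ≡ dH (point k) (point l)) → ⊥
      disjoint d∈ (k , l , k∈ , l∈ , _ , e) with ∈-map⁻ (dH (point i)) d∈
      ... | v , v∈ , refl with ∈-map⁻ point v∈
      ...   | j , j∈ , refl with det (here refl) (there j∈) (there k∈) (there l∈) (i≢ j∈) e
      ...     | inj₁ (i≡k , _) = i≢ k∈ i≡k
      ...     | inj₂ (i≡l , _) = i≢ l∈ i≡l

rainbowSubset : ∃[ M ] (∀ n (S : List (F₂^ n)) → Unique S →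
                ∃[ R ] (RainbowSubset S R × n * length S ≤ 2 ^ n * (M * (length R * length R))))
rainbowSubset = proj₁ komlósSulyokSzemerédi , λ n S uniq →
    construct (proj₁ komlósSulyokSzemerédi) n S (densePath n uniq) (proj₂ komlósSulyokSzemerédi n)
  where
  construct : ∀ M n (S : List (F₂^ n)) →
    ∃[ x ] (n * length S ≤ 2 ^ n * ∑ n (λ a → 𝟙 (flipPrefix x a ∈? S))) →
    (∀ x → (∀ a → x a ≤ 1) → 1 ≤ ∑ n x → SidonSelection M n x) →
    ∃[ R ] (RainbowSubset S R × n * length S ≤ 2 ^ n * (M * (length R * length R)))
  construct M n S (x , dense) select = decide (1 ≤? ∑ n χ)
    where
    χ : ℕ → ℕ
    χ a = 𝟙 (flipPrefix x a ∈? S)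
    decide : Dec (1 ≤ ∑ n χ) → ∃[ R ] (RainbowSubset S R × n * length S ≤ 2 ^ n * (M * (length R * length R)))
    -- If even the best path misses S, then n |S| = 0 and the empty set will do.
    decide (no ≱1) = [] , (([] , []) , []) ,
      ≤-trans dense (*-monoʳ-≤ (2 ^ n) (≤-trans (≤-reflexive (n<1⇒n≡0 (≰⇒> ≱1))) z≤n))
    decide (yes 1≤) with select χ (λ a → 𝟙≤1 (flipPrefix x a ∈? S)) 1≤
    ... | is , a , uniq , good , sidon , many = map point is ,
        (rainbow point uniq determine , All.map⁺ (All.tabulate λ i∈ → 𝟙⁻¹ (flipPrefix x (a _) ∈? S) (proj₂ (good i∈)))) ,
        ≤-trans dense (*-monoʳ-≤ (2 ^ n) (≤-trans many (≤-reflexive (cong (λ k → M * (k * k)) (sym (length-map point is))))))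
      where
      point : ℕ → F₂^ n
      point i = flipPrefix x (a i)
      a≤n : ∀ {i} → i ∈ is → a i ≤ n
      a≤n i∈ = <⇒≤ (proj₁ (good i∈))
      determine : DistancesDetermine point is
      determine {i} {j} {k} {l} i∈ j∈ k∈ l∈ i≢j e = sidon i∈ j∈ k∈ l∈ i≢j
        (trans (sym (dH-flipPrefix x (a i) (a j) (a≤n i∈) (a≤n j∈)))
               (trans e (dH-flipPrefix x (a k) (a l) (a≤n k∈) (a≤n l∈))))

-- Rational densities and the final constant

toℚ-* : ∀ a b → toℚ (a * b) ≡ toℚ a *ℚ toℚ b
toℚ-* a b = ℚ.toℚᵘ-injective (begin
  toℚᵘ (toℚ (a * b))                         ≈⟨ ℚ.toℚᵘ-fromℚᵘ (mkℚᵘ (ℤ.+ (a * b)) 0) ⟩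
  mkℚᵘ (ℤ.+ (a * b)) 0                         ≡⟨ cong (λ z → mkℚᵘ z 0) (ℤ.pos-* a b) ⟩
  mkℚᵘ (ℤ.+ a) 0 ℚᵘ.* mkℚᵘ (ℤ.+ b) 0             ≈⟨ ℚᵘ.*-cong (ℚ.toℚᵘ-fromℚᵘ (mkℚᵘ (ℤ.+ a) 0)) (ℚ.toℚᵘ-fromℚᵘ (mkℚᵘ (ℤ.+ b) 0)) ⟨
  toℚᵘ (toℚ a) ℚᵘ.* toℚᵘ (toℚ b)             ≈⟨ ℚ.toℚᵘ-homo-* (toℚ a) (toℚ b) ⟨
  toℚᵘ (toℚ a *ℚ toℚ b)                      ∎)
  where
  open ℚᵘ.≃-Reasoning

toℚ-mono : ∀ {a b} → a ≤ b → toℚ a ≤ℚ toℚ b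
toℚ-mono {a} {b} a≤b = ℚ.toℚᵘ-cancel-≤ (begin
  toℚᵘ (toℚ a)    ≃⟨ ℚ.toℚᵘ-fromℚᵘ (mkℚᵘ (ℤ.+ a) 0) ⟩
  mkℚᵘ (ℤ.+ a) 0    ≤⟨ *≤* (ℤ.*-monoʳ-≤-nonNeg (ℤ.+ 1) (ℤ.+≤+ a≤b)) ⟩
  mkℚᵘ (ℤ.+ b) 0    ≃⟨ ℚ.toℚᵘ-fromℚᵘ (mkℚᵘ (ℤ.+ b) 0) ⟨
  toℚᵘ (toℚ b)    ∎)
  where open ℚᵘ.≤-Reasoning

toℚ-pos : ∀ a .{{_ : NonZero a}} → Positive (toℚ a)
toℚ-pos (suc a) = ℚ.normalize-pos (suc a) 1

toℚ-nonNeg : ∀ a → NonNegative (toℚ a)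
toℚ-nonNeg a = ℚ.normalize-nonNeg a 1

density-bound : ∀ {α n s K} N .{{_ : NonZero N}} → α *ℚ toℚ N ≤ℚ toℚ s → n * s ≤ N * K → α *ℚ toℚ n ≤ℚ toℚ K
density-bound {α} {n} {s} {K} N αN≤s ns≤NK = ℚ.*-cancelʳ-≤-pos (toℚ N) {{toℚ-pos N}} (begin
  α *ℚ toℚ n *ℚ toℚ N        ≡⟨ ℚ.*-assoc α (toℚ n) (toℚ N) ⟩
  α *ℚ (toℚ n *ℚ toℚ N)      ≡⟨ cong (α *ℚ_) (ℚ.*-comm (toℚ n) (toℚ N)) ⟩
  α *ℚ (toℚ N *ℚ toℚ n)      ≡⟨ ℚ.*-assoc α (toℚ N) (toℚ n) ⟨
  α *ℚ toℚ N *ℚ toℚ n        ≤⟨ ℚ.*-monoʳ-≤-nonNeg (toℚ n) {{toℚ-nonNeg n}} αN≤s ⟩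
  toℚ s *ℚ toℚ n             ≡⟨ toℚ-* s n ⟨
  toℚ (s * n)                ≡⟨ cong toℚ (*-comm s n) ⟩
  toℚ (n * s)                ≤⟨ toℚ-mono ns≤NK ⟩
  toℚ (N * K)                ≡⟨ cong toℚ (*-comm N K) ⟩
  toℚ (K * N)                ≡⟨ toℚ-* K N ⟩
  toℚ K *ℚ toℚ N             ∎)
  where open ℚ.≤-Reasoning

module _ (M : ℕ) where

  private instance
    M⁺-pos : Positive (toℚ (suc M))
    M⁺-pos = toℚ-pos (suc M)
    M⁺-nonZero : NonZeroℚ (toℚ (suc M))
    M⁺-nonZero = ℚ.pos⇒nonZero (toℚ (suc M))

  -- All that matters is c² M ≤ 1. The natural choice M^(-1/2) may be irrational; 1/(M + 1) is
  -- rational, and also defined for M = 0.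
  c : ℚ
  c = 1/ toℚ (suc M)

  private instance
    c-pos : Positive c
    c-pos = ℚ.1/pos⇒pos (toℚ (suc M))
    c-nonNeg : NonNegative c
    c-nonNeg = ℚ.pos⇒nonNeg c
    c²-nonNeg : NonNegative (c *ℚ c)
    c²-nonNeg = ℚ.nonNeg*nonNeg⇒nonNeg c c

  0<c : 0ℚ <ℚ c
  0<c = ℚ.positive⁻¹ c

  cancel-c² : ∀ {v k} → v ≤ℚ toℚ (M * k) → c *ℚ c *ℚ v ≤ℚ toℚ k
  cancel-c² {v} {k} v≤ = begin
    c *ℚ c *ℚ v                                     ≤⟨ ℚ.*-monoˡ-≤-nonNeg (c *ℚ c) v≤ ⟩
    c *ℚ c *ℚ toℚ (M * k)                           ≤⟨ ℚ.*-monoˡ-≤-nonNeg (c *ℚ c) (toℚ-mono Mk≤) ⟩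
    c *ℚ c *ℚ toℚ (suc M * (suc M * k))             ≡⟨ ℚ.*-assoc c c _ ⟩
    c *ℚ (c *ℚ toℚ (suc M * (suc M * k)))           ≡⟨ cong (c *ℚ_) (c-cancel (suc M * k)) ⟩
    c *ℚ toℚ (suc M * k)                            ≡⟨ c-cancel k ⟩
    toℚ k                                           ∎
    where
    open ℚ.≤-Reasoning
    Mk≤ : M * k ≤ suc M * (suc M * k)
    Mk≤ = *-mono-≤ (n≤1+n M) (m≤m+n k (M * k))
    c-cancel : ∀ k → c *ℚ toℚ (suc M * k) ≡ toℚ k
    c-cancel k = trans (cong (c *ℚ_) (toℚ-* (suc M) k)) (trans (sym (ℚ.*-assoc c (toℚ (suc M)) (toℚ k)))
      (trans (cong (_*ℚ toℚ k) (ℚ.*-inverseˡ (toℚ (suc M)))) (ℚ.*-identityˡ (toℚ k))))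

scaleRainbow :
  ∃[ M ] (∀ n (S : List (F₂^ n)) → Unique S →
    ∃[ R ] (RainbowSubset S R × n * length S ≤ 2 ^ n * (M * (length R * length R)))) →
  ∃[ c ] (0ℚ <ℚ c × (∀ (n : ℕ) → 1 ≤ n → (α : ℚ) → 0ℚ ≤ℚ α → α ≤ℚ 1ℚ →
    (S : List (F₂^ n)) → Unique S → α *ℚ toℚ (2 ^ n) ≤ℚ toℚ (length S) →
    ∃[ R ] (RainbowSubset S R × c *ℚ c *ℚ α *ℚ toℚ n ≤ℚ toℚ (length R * length R))))
scaleRainbow (M , large) = c M , 0<c M , λ n _ α _ _ S uniq dense →
  let R , R-rainbow , bound = large n S uniq in
  R , R-rainbow ,
    subst (_≤ℚ toℚ (length R * length R)) (sym (ℚ.*-assoc (c M *ℚ c M) α (toℚ n)))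
      (cancel-c² M {k = length R * length R} (density-bound {α} {n} {length S} {M * (length R * length R)} (2 ^ n) {{m^n≢0 2 n}} dense bound))

theorem1p6 : ∃[ c ] (0ℚ <ℚ c × (∀ (n : ℕ) → 1 ≤ n → (α : ℚ) → 0ℚ ≤ℚ α → α ≤ℚ 1ℚ →
    (S : List (F₂^ n)) → Unique S → α *ℚ toℚ (2 ^ n) ≤ℚ toℚ (length S) →
    ∃[ R ] (RainbowSubset S R × c *ℚ c *ℚ α *ℚ toℚ n ≤ℚ toℚ (length R * length R))))
theorem1p6 = scaleRainbow rainbowSubset
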